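{- Let $r\geq 2$ be an integer. Then there exist $c,\varepsilon>0$ (depending only on $r$) such that the following holds. Let $H$ be an $r$-uniform $d$-regular hypergraph on $n$ vertices, where $d\leq \varepsilon n^{1/2}$. Then $$\mathrm{bw}(H)\leq e(H)\cdot\left(1-\frac{1}{2^{r-1}}\right)-c\sqrt{d}\,n.$$
   Context: An equipartition of a finite set is a partition into two parts whose sizes differ by at most one. A bisection of a hypergraph $H$ is an equipartition $V(H)=X\cup Y$ of its vertex set together with all edges that contain at least one vertex in each part; its size is the number of such edges. The bisection width $\mathrm{bw}(H)$ is the minimum size of a bisection of $H$. $e(H)$ denotes the number of edges of $H$. A hypergraph is $d$-regular if every vertex lies in exactly $d$ edges. -}

module Defs where

open import Data.Nat.Base as ℕ using (ℕ; zero; suc; z≤n; ∣_-_∣)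
import Data.Nat.Properties as ℕ
open import Data.Integer.Base using (+_)
open import Data.Rational.Base using (ℚ; _/_; _*_; _-_; _≤_)
open import Data.Fin.Base using (Fin)
open import Data.Fin.Subset using (Subset; inside; outside; _∩_; ∁; ∣_∣; Nonempty)
open import Data.Fin.Subset.Properties using (_∈?_; nonempty?)
open import Data.Vec.Base using ([]; _∷_)
open import Data.List.Base as List using (List; length; filter; map; _++_)
open import Data.List.Extrema.Nat using (argmin; argmin-all; f[argmin]≤f[xs])
open import Data.List.Membership.Propositional using () renaming (_∈_ to _∈ᴸ_)
open import Data.List.Membership.Propositional.Properties using (∈-map⁺; ∈-++⁺ˡ; ∈-++⁺ʳ; ∈-filter⁺)
open import Data.List.Relation.Unary.All as All using (All)
open import Data.List.Relation.Unary.All.Properties using (all-filter)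
open import Data.List.Relation.Unary.Any using (here)
open import Data.List.Relation.Unary.Unique.Propositional using (Unique)
open import Data.Product.Base using (_×_; _,_; ∃)
open import Relation.Binary.PropositionalEquality using (_≡_; refl)
open import Relation.Nullary.Decidable using (Dec; _×-dec_)

record Hypergraph (n : ℕ) : Set where
  field
    edges    : List (Subset n)
    distinct : Unique edges

open Hypergraph public

e : ∀ {n} → Hypergraph n → ℕ
e H = length (edges H)

degree : ∀ {n} → Hypergraph n → Fin n → ℕ
degree H v = length (filter (v ∈?_) (edges H))

Uniform : ∀ {n} → ℕ → Hypergraph n → Set
Uniform r H = All (λ f → ∣ f ∣ ≡ r) (edges H)

Regular : ∀ {n} → ℕ → Hypergraph n → Set
Regular d H = ∀ v → degree H v ≡ d

-- A partition V = X ∪ Y into two parts is represented by X, with Y = ∁ X.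
Equipartition : ∀ {n} → Subset n → Set
Equipartition X = ∣_-_∣ ∣ X ∣ ∣ ∁ X ∣ ℕ.≤ 1

equipartition? : ∀ {n} (X : Subset n) → Dec (Equipartition X)
equipartition? X = ∣_-_∣ ∣ X ∣ ∣ ∁ X ∣ ℕ.≤? 1

Crosses : ∀ {n} → Subset n → Subset n → Set
Crosses X f = Nonempty (f ∩ X) × Nonempty (f ∩ ∁ X)

crosses? : ∀ {n} (X f : Subset n) → Dec (Crosses X f)
crosses? X f = nonempty? (f ∩ X) ×-dec nonempty? (f ∩ ∁ X)

cutSize : ∀ {n} → Hypergraph n → Subset n → ℕ
cutSize H X = length (filter (crosses? X) (edges H))

subsets : ∀ n → List (Subset n)
subsets zero    = List.[ [] ]
subsets (suc n) = map (inside ∷_) (subsets n) ++ map (outside ∷_) (subsets n)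

equipartitions : ∀ n → List (Subset n)
equipartitions n = filter equipartition? (subsets n)

alternating : ∀ n → Subset n
alternating zero          = []
alternating (suc zero)    = inside ∷ []
alternating (suc (suc n)) = inside ∷ outside ∷ alternating n

-- `argmin` needs a starting point; `alternating n` is itself an equipartition,
-- so this is the minimum over all equipartitions (bw-attained and bw-minimal).
bw : ∀ {n} → Hypergraph n → ℕ
bw {n} H = cutSize H (argmin (cutSize H) (alternating n) (equipartitions n))

alternating-equipartition : ∀ n → Equipartition (alternating n)
alternating-equipartition zero          = z≤n
alternating-equipartition (suc zero)    = ℕ.≤-refl
alternating-equipartition (suc (suc n)) = alternating-equipartition n

∈-subsets : ∀ {n} (X : Subset n) → X ∈ᴸ subsets n
∈-subsets []            = here refl
∈-subsets (inside  ∷ X) = ∈-++⁺ˡ (∈-map⁺ (inside ∷_) (∈-subsets X))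
∈-subsets (outside ∷ X) = ∈-++⁺ʳ (map (inside ∷_) (subsets _)) (∈-map⁺ (outside ∷_) (∈-subsets X))

bw-attained : ∀ {n} (H : Hypergraph n) → ∃ λ X → Equipartition X × cutSize H X ≡ bw H
bw-attained {n} H =
  _ , argmin-all (cutSize H) (alternating-equipartition n) (all-filter equipartition? (subsets n)) , refl

bw-minimal : ∀ {n} (H : Hypergraph n) X → Equipartition X → bw H ℕ.≤ cutSize H X
bw-minimal {n} H X eq =
  All.lookup (f[argmin]≤f[xs] (alternating n) (equipartitions n)) (∈-filter⁺ equipartition? (∈-subsets X) eq)

ι : ℕ → ℚ
ι k = + k / 1

1/2^_ : ℕ → ℚ
1/2^ k = _/_ (+ 1) (2 ℕ.^ k) {{ℕ.m^n≢0 2 k}}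

-- Real inequalities involving √m, for a rational coefficient b ≥ 0, expressed in ℚ:
--   k ≤ b √m      iff  k² ≤ b² m                        (k ≥ 0);
--   x ≤ y − b √m  iff  x ≤ y  and  b² m ≤ (y − x)².
infix 4 _≤[_]√_ _≤_−[_]√_

_≤[_]√_ : ℕ → ℚ → ℕ → Set
k ≤[ b ]√ m = ι k * ι k ≤ b * b * ι m

_≤_−[_]√_ : ℚ → ℚ → ℚ → ℕ → Set
x ≤ y −[ b ]√ m = x ≤ y × b * b * ι m ≤ (y - x) * (y - x)

{-# OPTIONS --safe #-}
module Submission where

-- Draw uniform signs z, let S_v be the sum of the signs over the closed neighbourhood of v
-- (its size is at most r d), and put a_v = (z_v + clamp (h S_v)) / 2 with h of order 1/√d. Colour
-- the vertices independently with bias p_v = (1 + a_v) / 2.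
--
-- * The p_v are increasing functions of z with mean 1/2, so by Harris' inequality an edge is
--   monochromatic with probability at least 2^(1-r) (1 + E a_u a_v) for any two of its vertices,
--   and E a_u a_v is at least E z_u clamp (h S_v) / 4, which is at least h / 8. Summed over the
--   edges this is a gain of order n √d.
-- * One z_i moves Σ a_v by at most 1 + h r d = O(√d), since clamp is 1-Lipschitz. By Efron-Stein
--   the imbalance of the colouring has mean square O(n d).
--
-- Recolouring arbitrary vertices repairs an imbalance of size O(√(n d)) at a cost of O(d √(n d))
-- edges, which is below the gain when d ≤ ε √n. Random choices become averages over the cube, and
-- √d is replaced by an integer q with d ≤ q² ≤ 4 d.

open import Defs
open import Level using (0ℓ)
open import Data.Bool.Base using (Bool; true; false; not)
open import Data.Bool.Properties using (not-involutive)
open import Data.Nat.Base as ℕ using (ℕ; zero; suc; _∸_)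
import Data.Nat.Properties as ℕ
import Data.Integer.Base as ℤ
import Data.Integer.Properties as ℤ
open import Data.Rational.Base hiding (∣_∣)
open import Data.Rational.Properties
import Data.Rational.Unnormalised.Base as ℚᵘ
import Data.Rational.Unnormalised.Properties as ℚᵘ
open import Data.Fin.Base using (Fin; zero; suc)
open import Data.Fin.Subset using (Subset; inside; outside; _∈_; _∉_; _∩_; ∁; ∣_∣; Nonempty; ⁅_⁆)
open import Data.Fin.Subset.Properties using (_∈?_; x∈p∩q⁻; x∈∁p⇒x∉p; ∣⁅x⁆∣≡1)
open import Data.Vec.Base as Vec using (Vec; []; _∷_; _[_]≔_; lookup; here; there)
open import Data.Vec.Properties using (map-[]≔; []=⇒lookup; lookup⇒[]=; lookup-map)
open import Data.List.Base using (List; []; _∷_; length; filter)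
open import Data.List.Properties using (filter-≐; length-filter)
open import Data.List.Membership.Propositional using () renaming (_∈_ to _∈ᴸ_)
open import Data.List.Relation.Unary.All as All using (All; []; _∷_)
open import Data.List.Relation.Unary.Any using (here; there)
open import Data.Product.Base using (_×_; _,_; ∃; ∃-syntax; proj₁; proj₂)
open import Data.Sum.Base using (_⊎_; inj₁; inj₂)
open import Function.Base using (_∘_)
open import Relation.Unary using (Decidable)
open import Relation.Nullary using (yes; no; contradiction)
open import Relation.Nullary.Decidable using (dec⇒maybe)
open import Relation.Binary.PropositionalEquality
open import Tactic.RingSolver.Core.AlmostCommutativeRing using (AlmostCommutativeRing; fromCommutativeRing)
open import Tactic.RingSolver using (solve-∀)

private variable
  n k : ℕ
  a b c d : ℚ

ring : AlmostCommutativeRing 0ℓ 0ℓ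
ring = fromCommutativeRing +-*-commutativeRing λ x → dec⇒maybe (0ℚ ≟ x)

-- Rational inequalities

0≤½ : 0ℚ ≤ ½
0≤½ = ≤ᵇ⇒≤ _

0≤1 : 0ℚ ≤ 1ℚ
0≤1 = ≤ᵇ⇒≤ _

0≤* : 0ℚ ≤ a → 0ℚ ≤ b → 0ℚ ≤ a * b
0≤* {a} {b} p q = nonNegative⁻¹ (a * b)
  {{nonNeg*nonNeg⇒nonNeg a {{nonNegative p}} b {{nonNegative q}}}}

0≤+ : 0ℚ ≤ a → 0ℚ ≤ b → 0ℚ ≤ a + b
0≤+ = +-mono-≤

*-monoˡ : 0ℚ ≤ c → a ≤ b → c * a ≤ c * b
*-monoˡ {c} p = *-monoˡ-≤-nonNeg c {{nonNegative p}}

*-mono : 0ℚ ≤ a → 0ℚ ≤ d → a ≤ b → c ≤ d → a * c ≤ b * d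
*-mono {a} {d} 0≤a 0≤d p q = ≤-trans (*-monoˡ 0≤a q) (*-monoʳ-≤-nonNeg d {{nonNegative 0≤d}} p)

-- Most estimates below exhibit the slack `c` as an evidently nonnegative expression and leave a
-- polynomial identity to the ring solver.
≤-by : 0ℚ ≤ c → a + c ≡ b → a ≤ b
≤-by {a = a} p eq = ≤-trans (≤-reflexive (sym (+-identityʳ a))) (≤-trans (+-monoʳ-≤ a p) (≤-reflexive eq))

a≤b⇒0≤b-a : a ≤ b → 0ℚ ≤ b - a
a≤b⇒0≤b-a {a} p = ≤-trans (≤-reflexive (sym (+-inverseʳ a))) (+-monoˡ-≤ (- a) p)

a+b-a≡b : ∀ a b → a + b - a ≡ b
a+b-a≡b = solve-∀ ring

a²b²≡[ab]² : ∀ a b → a * a * (b * b) ≡ a * b * (a * b)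
a²b²≡[ab]² = solve-∀ ring

neg*neg : ∀ a → - a * - a ≡ a * a
neg*neg = solve-∀ ring

0≤a² : ∀ a → 0ℚ ≤ a * a
0≤a² a with ≤-total 0ℚ a
... | inj₁ p = 0≤* p p
... | inj₂ p = ≤-trans (0≤* (neg-antimono-≤ p) (neg-antimono-≤ p)) (≤-reflexive (neg*neg a))

ι-mono : ∀ {m k} → m ℕ.≤ k → ι m ≤ ι k
ι-mono {m} {k} p = toℚᵘ-cancel-≤
  (ℚᵘ.≤-respˡ-≃ (ℚᵘ.≃-sym (toℚᵘ-fromℚᵘ (ℚᵘ.mkℚᵘ (ℤ.+ m) 0)))
    (ℚᵘ.≤-respʳ-≃ (ℚᵘ.≃-sym (toℚᵘ-fromℚᵘ (ℚᵘ.mkℚᵘ (ℤ.+ k) 0)))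
      (ℚᵘ.*≤* (ℤ.*-monoʳ-≤-nonNeg (ℤ.+ 1) (ℤ.+≤+ p)))))

0≤ι : ∀ m → 0ℚ ≤ ι m
0≤ι m = ι-mono {0} {m} ℕ.z≤n

ι-+ : ∀ m k → ι (m ℕ.+ k) ≡ ι m + ι k
ι-+ m k = toℚᵘ-injective (begin
  toℚᵘ (ι (m ℕ.+ k))
    ≈⟨ toℚᵘ-fromℚᵘ (ℚᵘ.mkℚᵘ (ℤ.+ (m ℕ.+ k)) 0) ⟩
  ℚᵘ.mkℚᵘ (ℤ.+ (m ℕ.+ k)) 0
    ≈⟨ ℚᵘ.*≡* (cong (ℤ._* ℤ.+ 1) (sym (cong₂ ℤ._+_ (ℤ.*-identityʳ (ℤ.+ m)) (ℤ.*-identityʳ (ℤ.+ k))))) ⟩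
  ℚᵘ.mkℚᵘ (ℤ.+ m) 0 ℚᵘ.+ ℚᵘ.mkℚᵘ (ℤ.+ k) 0
    ≈⟨ ℚᵘ.≃-sym (ℚᵘ.+-cong (toℚᵘ-fromℚᵘ (ℚᵘ.mkℚᵘ (ℤ.+ m) 0)) (toℚᵘ-fromℚᵘ (ℚᵘ.mkℚᵘ (ℤ.+ k) 0))) ⟩
  toℚᵘ (ι m) ℚᵘ.+ toℚᵘ (ι k)
    ≈⟨ ℚᵘ.≃-sym (toℚᵘ-homo-+ (ι m) (ι k)) ⟩
  toℚᵘ (ι m + ι k) ∎)
  where open ℚᵘ.≃-Reasoning

ι-suc : ∀ m → ι (suc m) ≡ 1ℚ + ι m
ι-suc = ι-+ 1

ι-suc-* : ∀ m x → x + ι m * x ≡ ι (suc m) * x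
ι-suc-* m x = trans (eq x (ι m)) (cong (_* x) (sym (ι-suc m)))
  where
  eq : ∀ x y → x + y * x ≡ (1ℚ + y) * x
  eq = solve-∀ ring

ι-* : ∀ m k → ι (m ℕ.* k) ≡ ι m * ι k
ι-* zero    k = sym (*-zeroˡ (ι k))
ι-* (suc m) k = begin
  ι (k ℕ.+ m ℕ.* k)     ≡⟨ ι-+ k (m ℕ.* k) ⟩
  ι k + ι (m ℕ.* k)     ≡⟨ cong (ι k +_) (ι-* m k) ⟩
  ι k + ι m * ι k       ≡⟨ ι-suc-* m (ι k) ⟩
  ι (suc m) * ι k       ∎
  where open ≡-Reasoning

-- Finite sums

∑ : (Fin n → ℚ) → ℚ
∑ {zero}  f = 0ℚ
∑ {suc n} f = f zero + ∑ (f ∘ suc)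

∑-cong : {f g : Fin n → ℚ} → (∀ i → f i ≡ g i) → ∑ f ≡ ∑ g
∑-cong {zero}  p = refl
∑-cong {suc n} p = cong₂ _+_ (p zero) (∑-cong (p ∘ suc))

∑-mono : {f g : Fin n → ℚ} → (∀ i → f i ≤ g i) → ∑ f ≤ ∑ g
∑-mono {zero}  p = ≤-refl
∑-mono {suc n} p = +-mono-≤ (p zero) (∑-mono (p ∘ suc))

+-interchange : ∀ w x y z → (w + x) + (y + z) ≡ (w + y) + (x + z)
+-interchange = solve-∀ ring

∑-+ : (f g : Fin n → ℚ) → ∑ (λ i → f i + g i) ≡ ∑ f + ∑ g
∑-+ {zero}  f g = refl
∑-+ {suc n} f g = trans (cong (f zero + g zero +_) (∑-+ (f ∘ suc) (g ∘ suc)))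
  (+-interchange (f zero) (g zero) (∑ (f ∘ suc)) (∑ (g ∘ suc)))

∑-* : ∀ c (f : Fin n → ℚ) → ∑ (λ i → c * f i) ≡ c * ∑ f
∑-* {zero}  c f = sym (*-zeroʳ c)
∑-* {suc n} c f = trans (cong (c * f zero +_) (∑-* c (f ∘ suc))) (sym (*-distribˡ-+ c (f zero) (∑ (f ∘ suc))))

∑-neg : (f : Fin n → ℚ) → ∑ (λ i → - f i) ≡ - ∑ f
∑-neg {zero}  f = refl
∑-neg {suc n} f = trans (cong (- f zero +_) (∑-neg (f ∘ suc))) (sym (neg-distrib-+ (f zero) (∑ (f ∘ suc))))

∑-const : ∀ n c → ∑ {n} (λ _ → c) ≡ ι n * c
∑-const zero    c = sym (*-zeroˡ c)
∑-const (suc n) c = trans (cong (c +_) (∑-const n c)) (ι-suc-* n c)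

∑ᴸ : ∀ {A : Set} → List A → (A → ℚ) → ℚ
∑ᴸ []       f = 0ℚ
∑ᴸ (x ∷ xs) f = f x + ∑ᴸ xs f

∑-∑ᴸ-swap : ∀ {A : Set} (xs : List A) (f : A → Fin n → ℚ) →
  ∑ (λ i → ∑ᴸ xs (λ x → f x i)) ≡ ∑ᴸ xs (λ x → ∑ (f x))
∑-∑ᴸ-swap {n} []       f = trans (∑-const n 0ℚ) (*-zeroʳ (ι n))
∑-∑ᴸ-swap     (x ∷ xs) f = trans (∑-+ (f x) _) (cong (∑ (f x) +_) (∑-∑ᴸ-swap xs f))

-- Product measures on the cube

Cube : ℕ → Set
Cube = Vec Bool

-- Expectation under the product of Bernoulli measures with parameters `p i`, computed by
-- conditioning on the first coordinate.
E : (Fin n → ℚ) → (Cube n → ℚ) → ℚ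
E {zero}  p F = F []
E {suc n} p F = p zero * E (p ∘ suc) (F ∘ (true ∷_)) + (1ℚ - p zero) * E (p ∘ suc) (F ∘ (false ∷_))

IsProb : (Fin n → ℚ) → Set
IsProb p = ∀ i → 0ℚ ≤ p i × p i ≤ 1ℚ

convex-const : ∀ q c → q * c + (1ℚ - q) * c ≡ c
convex-const = solve-∀ ring

convex : ∀ {q s t m} → 0ℚ ≤ q × q ≤ 1ℚ → s ≤ m → t ≤ m → q * s + (1ℚ - q) * t ≤ m
convex {q} {m = m} (0≤q , q≤1) s≤m t≤m =
  ≤-trans (+-mono-≤ (*-monoˡ 0≤q s≤m) (*-monoˡ (a≤b⇒0≤b-a q≤1) t≤m)) (≤-reflexive (convex-const q m))

E-cong : (p : Fin n → ℚ) {F G : Cube n → ℚ} → (∀ z → F z ≡ G z) → E p F ≡ E p G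
E-cong {zero}  p h = h []
E-cong {suc n} p h = cong₂ (λ s t → p zero * s + (1ℚ - p zero) * t)
  (E-cong (p ∘ suc) (h ∘ (true ∷_))) (E-cong (p ∘ suc) (h ∘ (false ∷_)))

E-+ : (p : Fin n → ℚ) (F G : Cube n → ℚ) → E p (λ z → F z + G z) ≡ E p F + E p G
E-+ {zero}  p F G = refl
E-+ {suc n} p F G = trans
  (cong₂ (λ s t → p zero * s + (1ℚ - p zero) * t) (E-+ (p ∘ suc) _ _) (E-+ (p ∘ suc) _ _))
  (eq (p zero) _ _ _ _)
  where
  eq : ∀ q s t u v → q * (s + t) + (1ℚ - q) * (u + v) ≡ (q * s + (1ℚ - q) * u) + (q * t + (1ℚ - q) * v)
  eq = solve-∀ ring

E-* : (p : Fin n → ℚ) → ∀ c (F : Cube n → ℚ) → E p (λ z → c * F z) ≡ c * E p F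
E-* {zero}  p c F = refl
E-* {suc n} p c F = trans
  (cong₂ (λ s t → p zero * s + (1ℚ - p zero) * t) (E-* (p ∘ suc) c _) (E-* (p ∘ suc) c _))
  (eq (p zero) c _ _)
  where
  eq : ∀ q c s t → q * (c * s) + (1ℚ - q) * (c * t) ≡ c * (q * s + (1ℚ - q) * t)
  eq = solve-∀ ring

E-const : (p : Fin n → ℚ) → ∀ c → E p (λ _ → c) ≡ c
E-const {zero}  p c = refl
E-const {suc n} p c = trans
  (cong₂ (λ s t → p zero * s + (1ℚ - p zero) * t) (E-const (p ∘ suc) c) (E-const (p ∘ suc) c))
  (convex-const (p zero) c)

E-mono : {p : Fin n → ℚ} → IsProb p → {F G : Cube n → ℚ} → (∀ z → F z ≤ G z) → E p F ≤ E p G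
E-mono {zero}  P h = h []
E-mono {suc n} P h = +-mono-≤
  (*-monoˡ (proj₁ (P zero)) (E-mono (P ∘ suc) (h ∘ (true ∷_))))
  (*-monoˡ (a≤b⇒0≤b-a (proj₂ (P zero))) (E-mono (P ∘ suc) (h ∘ (false ∷_))))

E-∑ᴸ : ∀ {A : Set} (p : Fin n → ℚ) (xs : List A) (F : A → Cube n → ℚ) →
  E p (λ z → ∑ᴸ xs (λ x → F x z)) ≡ ∑ᴸ xs (λ x → E p (F x))
E-∑ᴸ p []       F = E-const p 0ℚ
E-∑ᴸ p (x ∷ xs) F = trans (E-+ p (F x) _) (cong (E p (F x) +_) (E-∑ᴸ p xs F))

-- The first-moment method: a convex combination of the two conditional means is at most the larger
-- of the values found in the two halves.
average-attained : {p : Fin n → ℚ} → IsProb p → (F : Cube n → ℚ) → ∃ λ z → E p F ≤ F z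
average-attained {zero}      P F = [] , ≤-refl
average-attained {suc n} {p} P F
  with average-attained (P ∘ suc) (F ∘ (true ∷_)) | average-attained (P ∘ suc) (F ∘ (false ∷_))
... | z₁ , h₁ | z₀ , h₀ with ≤-total (F (true ∷ z₁)) (F (false ∷ z₀))
... | inj₁ le = false ∷ z₀ , convex (P zero) (≤-trans h₁ le) h₀
... | inj₂ le = true ∷ z₁ , convex (P zero) h₁ (≤-trans h₀ le)

-- Correlation and variance under the uniform measure

coin : Fin n → ℚ
coin _ = ½

U : (Cube n → ℚ) → ℚ
U = E coin

coin-isProb : IsProb {n} coin
coin-isProb _ = 0≤½ , ≤ᵇ⇒≤ _

U-mono : {F G : Cube n → ℚ} → (∀ z → F z ≤ G z) → U F ≤ U G
U-mono = E-mono coin-isProb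

Monotone : (Cube n → ℚ) → Set
Monotone F = ∀ z i → F (z [ i ]≔ false) ≤ F (z [ i ]≔ true)

Monotone-* : {F G : Cube n → ℚ} → (∀ z → 0ℚ ≤ F z) → (∀ z → 0ℚ ≤ G z) →
  Monotone F → Monotone G → Monotone (λ z → F z * G z)
Monotone-* 0≤F 0≤G mF mG z i = *-mono (0≤F _) (0≤G _) (mF z i) (mG z i)

-- Condition on the first coordinate. Each half is handled by induction, and combining the halves
-- leaves the covariance of the conditional means, (f₁ - f₀)(g₁ - g₀)/4, where both factors are
-- nonnegative by monotonicity.
harris : (F G : Cube n → ℚ) → Monotone F → Monotone G → U F * U G ≤ U (λ z → F z * G z)
harris {zero}  F G mF mG = ≤-refl
harris {suc n} F G mF mG = ≤-trans
  (≤-by (0≤* (0≤a² ½) (0≤* (a≤b⇒0≤b-a (section F mF)) (a≤b⇒0≤b-a (section G mG))))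
        (eq (U (F ∘ (true ∷_))) (U (F ∘ (false ∷_))) (U (G ∘ (true ∷_))) (U (G ∘ (false ∷_)))))
  (+-mono-≤ (*-monoˡ 0≤½ (harris _ _ (λ z i → mF (true ∷ z) (suc i)) (λ z i → mG (true ∷ z) (suc i))))
            (*-monoˡ 0≤½ (harris _ _ (λ z i → mF (false ∷ z) (suc i)) (λ z i → mG (false ∷ z) (suc i)))))
  where
  section : (F : Cube (suc n) → ℚ) → Monotone F → U (F ∘ (false ∷_)) ≤ U (F ∘ (true ∷_))
  section F mF = U-mono (λ z → mF (true ∷ z) zero)
  eq : ∀ f₁ f₀ g₁ g₀ →
    (½ * f₁ + (1ℚ - ½) * f₀) * (½ * g₁ + (1ℚ - ½) * g₀) + ½ * ½ * ((f₁ - f₀) * (g₁ - g₀))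
      ≡ ½ * (f₁ * g₁) + (1ℚ - ½) * (f₀ * g₀)
  eq = solve-∀ ring

-- Revealing the first coordinate splits the variance into the mean of the conditional variances and
-- the variance (f₁ - f₀)²/4 of the conditional means. Averaging the increment bound gives f₁ - f₀ ≤
-- `B zero`, and monotonicity gives 0 ≤ f₁ - f₀, so this may be squared.
efron-stein : (F : Cube n → ℚ) (B : Fin n → ℚ) → Monotone F →
  (∀ z i → F (z [ i ]≔ true) ≤ F (z [ i ]≔ false) + B i) →
  U (λ z → F z * F z) ≤ U F * U F + ½ * ½ * ∑ (λ i → B i * B i)
efron-stein {zero}  F B mF bF = ≤-by ≤-refl refl
efron-stein {suc n} F B mF bF = ≤-trans
  (+-mono-≤ (*-monoˡ 0≤½ (ih true)) (*-monoˡ 0≤½ (ih false)))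
  (≤-trans (≤-reflexive (eq₁ f₁ f₀ Q))
    (+-monoʳ-≤ (U F * U F) (*-monoˡ (0≤a² ½) (+-monoˡ-≤ Q sq≤))))
  where
  f₁ = U (F ∘ (true ∷_))
  f₀ = U (F ∘ (false ∷_))
  Q = ∑ (λ i → B (suc i) * B (suc i))
  ih : ∀ b → U (λ z → F (b ∷ z) * F (b ∷ z)) ≤ U (F ∘ (b ∷_)) * U (F ∘ (b ∷_)) + ½ * ½ * Q
  ih b = efron-stein (F ∘ (b ∷_)) (B ∘ suc) (λ z i → mF (b ∷ z) (suc i)) (λ z i → bF (b ∷ z) (suc i))
  f₀≤f₁ : f₀ ≤ f₁
  f₀≤f₁ = U-mono (λ z → mF (true ∷ z) zero)
  f₁≤f₀+B : f₁ ≤ f₀ + B zero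
  f₁≤f₀+B = ≤-trans (U-mono (λ z → bF (true ∷ z) zero))
    (≤-reflexive (trans (E-+ coin (F ∘ (false ∷_)) (λ _ → B zero))
                        (cong (_+_ f₀) (E-const {n} coin (B zero)))))
  diff≤B : f₁ - f₀ ≤ B zero
  diff≤B = ≤-trans (+-monoˡ-≤ (- f₀) f₁≤f₀+B) (≤-reflexive (a+b-a≡b f₀ (B zero)))
  sq≤ : (f₁ - f₀) * (f₁ - f₀) ≤ B zero * B zero
  sq≤ = *-mono (a≤b⇒0≤b-a f₀≤f₁) (≤-trans (a≤b⇒0≤b-a f₀≤f₁) diff≤B) diff≤B diff≤B
  eq₁ : ∀ x y q → ½ * (x * x + ½ * ½ * q) + (1ℚ - ½) * (y * y + ½ * ½ * q)
    ≡ (½ * x + (1ℚ - ½) * y) * (½ * x + (1ℚ - ½) * y) + ½ * ½ * ((x - y) * (x - y) + q)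
  eq₁ = solve-∀ ring

-- Sign-flip symmetry and influences

negate : Cube n → Cube n
negate = Vec.map not

U-negate : (F : Cube n → ℚ) → U (F ∘ negate) ≡ U F
U-negate {zero}  F = refl
U-negate {suc n} F = trans
  (cong₂ (λ s t → ½ * s + (1ℚ - ½) * t) (U-negate (F ∘ (false ∷_))) (U-negate (F ∘ (true ∷_))))
  (eq (U (F ∘ (true ∷_))) (U (F ∘ (false ∷_))))
  where
  eq : ∀ s t → ½ * t + (1ℚ - ½) * s ≡ ½ * s + (1ℚ - ½) * t
  eq = solve-∀ ring

Odd : (Cube n → ℚ) → Set
Odd F = ∀ z → F (negate z) ≡ - F z

U-odd : {F : Cube n → ℚ} → Odd F → U F ≡ 0ℚ
U-odd {F = F} odd = begin
  U F                                    ≡⟨ eq₁ (U F) ⟩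
  ½ * U F + ½ * U F                      ≡⟨ cong (λ s → ½ * U F + ½ * s) (sym (U-negate F)) ⟩
  ½ * U F + ½ * U (F ∘ negate)           ≡⟨ cong (λ s → ½ * U F + ½ * s) (E-cong coin (λ z → trans (odd z) (eq₂ (F z)))) ⟩
  ½ * U F + ½ * U (λ z → - 1ℚ * F z)     ≡⟨ cong (λ s → ½ * U F + ½ * s) (E-* coin (- 1ℚ) F) ⟩
  ½ * U F + ½ * (- 1ℚ * U F)             ≡⟨ eq₃ (U F) ⟩
  0ℚ                                     ∎
  where
  open ≡-Reasoning
  eq₁ : ∀ x → x ≡ ½ * x + ½ * x
  eq₁ = solve-∀ ring
  eq₂ : ∀ x → - x ≡ - 1ℚ * x
  eq₂ = solve-∀ ring
  eq₃ : ∀ x → ½ * x + ½ * (- 1ℚ * x) ≡ 0ℚ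
  eq₃ = solve-∀ ring

sgn : Bool → ℚ
sgn true  = 1ℚ
sgn false = - 1ℚ

sgn-not : ∀ b → sgn (not b) ≡ - sgn b
sgn-not true  = refl
sgn-not false = refl

-- Discrete integration by parts: correlation with a coordinate is half the mean derivative in its
-- direction. The derivative ignores that coordinate, so averaging over it changes nothing.
U-influence : (i : Fin n) (G : Cube n → ℚ) →
  U (λ z → sgn (lookup z i) * G z) ≡ ½ * U (λ z → G (z [ i ]≔ true) - G (z [ i ]≔ false))
U-influence {suc n} zero G = begin
  ½ * U (λ z → 1ℚ * G₁ z) + (1ℚ - ½) * U (λ z → - 1ℚ * G₀ z)
    ≡⟨ cong₂ (λ s t → ½ * s + (1ℚ - ½) * t) (E-* coin 1ℚ G₁) (E-* coin (- 1ℚ) G₀) ⟩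
  ½ * (1ℚ * U G₁) + (1ℚ - ½) * (- 1ℚ * U G₀)
    ≡⟨ eq (U G₁) (U G₀) ⟩
  ½ * (½ * (U G₁ + - 1ℚ * U G₀) + (1ℚ - ½) * (U G₁ + - 1ℚ * U G₀))
    ≡⟨ cong (λ s → ½ * (½ * s + (1ℚ - ½) * s)) (sym diff) ⟩
  ½ * (½ * U (λ z → G₁ z - G₀ z) + (1ℚ - ½) * U (λ z → G₁ z - G₀ z)) ∎
  where
  open ≡-Reasoning
  G₁ = G ∘ (true ∷_)
  G₀ = G ∘ (false ∷_)
  eq : ∀ s t → ½ * (1ℚ * s) + (1ℚ - ½) * (- 1ℚ * t) ≡ ½ * (½ * (s + - 1ℚ * t) + (1ℚ - ½) * (s + - 1ℚ * t))
  eq = solve-∀ ring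
  eq₂ : ∀ s t → s - t ≡ s + - 1ℚ * t
  eq₂ = solve-∀ ring
  diff : U (λ z → G₁ z - G₀ z) ≡ U G₁ + - 1ℚ * U G₀
  diff = trans (E-cong coin (λ z → eq₂ (G₁ z) (G₀ z)))
    (trans (E-+ coin G₁ (λ z → - 1ℚ * G₀ z)) (cong (_+_ (U G₁)) (E-* coin (- 1ℚ) G₀)))
U-influence {suc n} (suc i) G = trans
  (cong₂ (λ s t → ½ * s + (1ℚ - ½) * t) (U-influence i (G ∘ (true ∷_))) (U-influence i (G ∘ (false ∷_))))
  (eq (U (λ z → G (true ∷ (z [ i ]≔ true)) - G (true ∷ (z [ i ]≔ false))))
      (U (λ z → G (false ∷ (z [ i ]≔ true)) - G (false ∷ (z [ i ]≔ false)))))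
  where
  eq : ∀ s t → ½ * (½ * s) + (1ℚ - ½) * (½ * t) ≡ ½ * (½ * s + (1ℚ - ½) * t)
  eq = solve-∀ ring

-- Multilinear extensions

prod : Subset n → (Fin n → ℚ) → ℚ
prod []            φ = 1ℚ
prod (inside  ∷ f) φ = φ zero * prod f (φ ∘ suc)
prod (outside ∷ f) φ = prod f (φ ∘ suc)

prod-cong : (f : Subset n) {φ ψ : Fin n → ℚ} → (∀ i → φ i ≡ ψ i) → prod f φ ≡ prod f ψ
prod-cong []            h = refl
prod-cong (inside  ∷ f) h = cong₂ _*_ (h zero) (prod-cong f (h ∘ suc))
prod-cong (outside ∷ f) h = prod-cong f (h ∘ suc)

-- Independence of the coordinates: every vertex contributes at most one factor, which can be
-- integrated separately.
E-prod : (p : Fin n → ℚ) (f : Subset n) (g : Bool → ℚ) →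
  E p (λ x → prod f (g ∘ lookup x)) ≡ prod f (λ i → p i * g true + (1ℚ - p i) * g false)
E-prod p []            g = refl
E-prod p (inside  ∷ f) g = trans
  (cong₂ (λ s t → p zero * s + (1ℚ - p zero) * t) (E-* (p ∘ suc) (g true) _) (E-* (p ∘ suc) (g false) _))
  (trans (eq (p zero) (g true) (g false) _)
    (cong ((p zero * g true + (1ℚ - p zero) * g false) *_) (E-prod (p ∘ suc) f g)))
  where
  eq : ∀ q s t m → q * (s * m) + (1ℚ - q) * (t * m) ≡ (q * s + (1ℚ - q) * t) * m
  eq = solve-∀ ring
E-prod p (outside ∷ f) g = trans (convex-const (p zero) _) (E-prod (p ∘ suc) f g)

imbalance : Cube n → ℚ
imbalance x = ∑ (sgn ∘ lookup x)

mean : (Fin n → ℚ) → ℚ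
mean p = ∑ (λ i → p i - (1ℚ - p i))

-- The shift `c` stores the signs already revealed, which lets the induction close. A sign with bias
-- q has variance 1 - (2q - 1)², and dropping the square leaves at most one per coordinate.
E-shifted-imbalance² : {p : Fin n → ℚ} → IsProb p → ∀ c →
  E p (λ x → (c + imbalance x) * (c + imbalance x)) ≤ (c + mean p) * (c + mean p) + ι n
E-shifted-imbalance² {zero}      P c = ≤-by ≤-refl refl
E-shifted-imbalance² {suc n} {p} P c = begin
  q * E p′ (λ x → (c + (1ℚ + Y x)) * (c + (1ℚ + Y x))) + (1ℚ - q) * E p′ (λ x → (c + (- 1ℚ + Y x)) * (c + (- 1ℚ + Y x)))
    ≡⟨ cong₂ (λ s t → q * s + (1ℚ - q) * t) (shift 1ℚ) (shift (- 1ℚ)) ⟩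
  q * E p′ (λ x → (c + 1ℚ + Y x) * (c + 1ℚ + Y x)) + (1ℚ - q) * E p′ (λ x → (c + - 1ℚ + Y x) * (c + - 1ℚ + Y x))
    ≤⟨ +-mono-≤ (*-monoˡ (proj₁ (P zero)) (E-shifted-imbalance² (P ∘ suc) (c + 1ℚ)))
                (*-monoˡ (a≤b⇒0≤b-a (proj₂ (P zero))) (E-shifted-imbalance² (P ∘ suc) (c + - 1ℚ))) ⟩
  q * ((c + 1ℚ + s) * (c + 1ℚ + s) + ι n) + (1ℚ - q) * ((c + - 1ℚ + s) * (c + - 1ℚ + s) + ι n)
    ≤⟨ ≤-by (0≤a² (q - (1ℚ - q))) (eq q c s (ι n)) ⟩
  (c + (q - (1ℚ - q) + s)) * (c + (q - (1ℚ - q) + s)) + (1ℚ + ι n)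
    ≡⟨ cong (_+_ ((c + mean p) * (c + mean p))) (sym (ι-suc n)) ⟩
  (c + mean p) * (c + mean p) + ι (suc n) ∎
  where
  open ≤-Reasoning
  q = p zero
  p′ = p ∘ suc
  s = mean p′
  Y : Cube n → ℚ
  Y = imbalance
  shift : ∀ t → E p′ (λ x → (c + (t + Y x)) * (c + (t + Y x))) ≡ E p′ (λ x → (c + t + Y x) * (c + t + Y x))
  shift t = E-cong p′ (λ x → cong (λ y → y * y) (sym (+-assoc c t (Y x))))
  eq : ∀ q c s m →
    q * ((c + 1ℚ + s) * (c + 1ℚ + s) + m) + (1ℚ - q) * ((c + - 1ℚ + s) * (c + - 1ℚ + s) + m) + (q - (1ℚ - q)) * (q - (1ℚ - q))
      ≡ (c + (q - (1ℚ - q) + s)) * (c + (q - (1ℚ - q) + s)) + (1ℚ + m)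
  eq = solve-∀ ring

E-imbalance² : {p : Fin n → ℚ} → IsProb p →
  E p (λ x → imbalance x * imbalance x) ≤ mean p * mean p + ι n
E-imbalance² {n} {p} P = begin
  E p (λ x → imbalance x * imbalance x)
    ≡⟨ E-cong p (λ x → sym (cong (λ y → y * y) (+-identityˡ (imbalance x)))) ⟩
  E p (λ x → (0ℚ + imbalance x) * (0ℚ + imbalance x))
    ≤⟨ E-shifted-imbalance² P 0ℚ ⟩
  (0ℚ + mean p) * (0ℚ + mean p) + ι n
    ≡⟨ cong (λ y → y * y + ι n) (+-identityˡ (mean p)) ⟩
  mean p * mean p + ι n ∎
  where open ≤-Reasoning

-- Truncation to [-1, 1]

clamp : ℚ → ℚ
clamp s = - 1ℚ ⊔ (s ⊓ 1ℚ)

-1≤1 : - 1ℚ ≤ 1ℚ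
-1≤1 = ≤ᵇ⇒≤ _

-1≤clamp : ∀ s → - 1ℚ ≤ clamp s
-1≤clamp s = p≤p⊔q (- 1ℚ) (s ⊓ 1ℚ)

clamp≤1 : ∀ s → clamp s ≤ 1ℚ
clamp≤1 s = ⊔-lub -1≤1 (p⊓q≤q s 1ℚ)

clamp-mono : a ≤ b → clamp a ≤ clamp b
clamp-mono le = ⊔-monoʳ-≤ (- 1ℚ) (⊓-monoˡ-≤ 1ℚ le)

clamp-id : - 1ℚ ≤ a → a ≤ 1ℚ → clamp a ≡ a
clamp-id {a} lo hi = trans (cong (- 1ℚ ⊔_) (p≤q⇒p⊓q≡p hi)) (p≤q⇒p⊔q≡q lo)

clamp-odd : ∀ s → clamp (- s) ≡ - clamp s
clamp-odd s with ≤-total s 1ℚ | ≤-total (- 1ℚ) s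
... | inj₁ s≤1 | inj₁ -1≤s = trans (clamp-id (neg-antimono-≤ s≤1) (neg-antimono-≤ -1≤s)) (cong -_ (sym (clamp-id -1≤s s≤1)))
... | inj₁ s≤1 | inj₂ s≤-1 = trans
  (trans (cong (- 1ℚ ⊔_) (p≥q⇒p⊓q≡q {p = - s} (neg-antimono-≤ s≤-1))) (p≤q⇒p⊔q≡q -1≤1))
  (cong -_ (sym (trans (cong (- 1ℚ ⊔_) (p≤q⇒p⊓q≡p s≤1)) (p≥q⇒p⊔q≡p s≤-1))))
... | inj₂ 1≤s | _ = trans
  (trans (cong (- 1ℚ ⊔_) (p≤q⇒p⊓q≡p {p = - s} (≤-trans (neg-antimono-≤ 1≤s) -1≤1))) (p≥q⇒p⊔q≡p (neg-antimono-≤ 1≤s)))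
  (cong -_ (sym (trans (cong (- 1ℚ ⊔_) (p≥q⇒p⊓q≡q 1≤s)) (p≤q⇒p⊔q≡q -1≤1))))

clamp-lipschitz : ∀ s → 0ℚ ≤ b → clamp (s + b) ≤ clamp s + b
clamp-lipschitz {b} s 0≤b = ⊔-lub (≤-trans (-1≤clamp s) (≤-by 0≤b refl)) upper
  where
  upper : (s + b) ⊓ 1ℚ ≤ clamp s + b
  upper with ≤-total s 1ℚ
  ... | inj₁ s≤1 = ≤-trans (p⊓q≤p (s + b) 1ℚ)
    (+-monoˡ-≤ b (≤-trans (≤-reflexive (sym (p≤q⇒p⊓q≡p s≤1))) (p≤q⊔p (- 1ℚ) (s ⊓ 1ℚ))))
  ... | inj₂ 1≤s = ≤-trans (p⊓q≤q (s + b) 1ℚ)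
    (≤-trans (≤-trans (≤-reflexive (sym (p≥q⇒p⊓q≡q 1≤s))) (p≤q⊔p (- 1ℚ) (s ⊓ 1ℚ))) (≤-by 0≤b refl))

a-b≤a+b : ∀ a {b} → 0ℚ ≤ b → a - b ≤ a + b
a-b≤a+b a {b} 0≤b = ≤-by (0≤+ 0≤b 0≤b) (eq a b)
  where
  eq : ∀ a b → (a - b) + (b + b) ≡ a + b
  eq = solve-∀ ring

1≤a⇒1≤a² : 1ℚ ≤ a → 1ℚ ≤ a * a
1≤a⇒1≤a² 1≤a = *-mono 0≤1 (≤-trans 0≤1 1≤a) 1≤a 1≤a

clamp-gain-far : ∀ s {b} → 0ℚ ≤ b → 1ℚ ≤ (s + s) * (s + s) →
  clamp (s - b) + (b + b) * (1ℚ - (s + s) * (s + s)) ≤ clamp (s + b)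
clamp-gain-far s {b} 0≤b far = ≤-trans
  (≤-by (0≤* (0≤+ 0≤b 0≤b) (a≤b⇒0≤b-a far)) (eq₁ (clamp (s - b)) b ((s + s) * (s + s))))
  (clamp-mono {s - b} {s + b} (a-b≤a+b s 0≤b))
  where
  eq₁ : ∀ x b y → x + (b + b) * (1ℚ - y) + (b + b) * (y - 1ℚ) ≡ x
  eq₁ = solve-∀ ring

-- The polynomial factor 1 - (2s)² stands in for the event that s is small, so that a second moment
-- suffices later. If both end points lie in [-1, 1], the gain is exactly 2b. Otherwise b ≤ 1/2
-- forces |2s| ≥ 1, the factor is nonpositive and monotonicity of `clamp` is enough.
clamp-gain : ∀ s {b} → 0ℚ ≤ b → b ≤ ½ →
  clamp (s - b) + (b + b) * (1ℚ - (s + s) * (s + s)) ≤ clamp (s + b)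
clamp-gain s {b} 0≤b b≤½ with ≤-total (s + b) 1ℚ | ≤-total (- 1ℚ) (s - b)
... | inj₁ hi | inj₁ lo = begin
  clamp (s - b) + (b + b) * (1ℚ - (s + s) * (s + s))
    ≡⟨ cong (_+ (b + b) * (1ℚ - (s + s) * (s + s))) (clamp-id lo (≤-trans (a-b≤a+b s 0≤b) hi)) ⟩
  (s - b) + (b + b) * (1ℚ - (s + s) * (s + s))
    ≤⟨ ≤-by (0≤* (0≤+ 0≤b 0≤b) (0≤a² (s + s))) (eq s b) ⟩
  s + b
    ≡⟨ sym (clamp-id (≤-trans lo (a-b≤a+b s 0≤b)) hi) ⟩
  clamp (s + b) ∎
  where
  open ≤-Reasoning
  eq : ∀ s b → (s - b) + (b + b) * (1ℚ - (s + s) * (s + s)) + (b + b) * ((s + s) * (s + s)) ≡ s + b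
  eq = solve-∀ ring
... | inj₂ 1≤s+b | _ = clamp-gain-far s 0≤b (1≤a⇒1≤a² (≤-by
  (0≤+ (0≤+ (a≤b⇒0≤b-a 1≤s+b) (a≤b⇒0≤b-a 1≤s+b)) (0≤+ (a≤b⇒0≤b-a b≤½) (a≤b⇒0≤b-a b≤½))) (eq s b)))
  where
  eq : ∀ s b → 1ℚ + ((s + b - 1ℚ + (s + b - 1ℚ)) + ((½ - b) + (½ - b))) ≡ s + s
  eq = solve-∀ ring
... | inj₁ _ | inj₂ s-b≤-1 = clamp-gain-far s 0≤b (≤-trans (1≤a⇒1≤a² (≤-by
  (0≤+ (0≤+ (a≤b⇒0≤b-a s-b≤-1) (a≤b⇒0≤b-a s-b≤-1)) (0≤+ (a≤b⇒0≤b-a b≤½) (a≤b⇒0≤b-a b≤½))) (eq s b)))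
  (≤-reflexive (neg*neg (s + s))))
  where
  eq : ∀ s b → 1ℚ + ((- 1ℚ - (s - b) + (- 1ℚ - (s - b))) + ((½ - b) + (½ - b))) ≡ - (s + s)
  eq = solve-∀ ring

-- Indicators, degrees and neighbourhoods

bit : Bool → ℚ
bit true  = 1ℚ
bit false = 0ℚ

bit-isProb : ∀ b → 0ℚ ≤ bit b × bit b ≤ 1ℚ
bit-isProb true  = 0≤1 , ≤-refl
bit-isProb false = ≤-refl , 0≤1

module _ {A : Set} where

  ∑ᴸ-mono : ∀ {xs : List A} {f g : A → ℚ} → All (λ x → f x ≤ g x) xs → ∑ᴸ xs f ≤ ∑ᴸ xs g
  ∑ᴸ-mono []       = ≤-refl
  ∑ᴸ-mono (p ∷ ps) = +-mono-≤ p (∑ᴸ-mono ps)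

  ∑ᴸ-cong : ∀ {xs : List A} {f g : A → ℚ} → All (λ x → f x ≡ g x) xs → ∑ᴸ xs f ≡ ∑ᴸ xs g
  ∑ᴸ-cong []       = refl
  ∑ᴸ-cong (p ∷ ps) = cong₂ _+_ p (∑ᴸ-cong ps)

  ∑ᴸ-* : ∀ c (xs : List A) (f : A → ℚ) → ∑ᴸ xs (λ x → c * f x) ≡ c * ∑ᴸ xs f
  ∑ᴸ-* c []       f = sym (*-zeroʳ c)
  ∑ᴸ-* c (x ∷ xs) f = trans (cong (c * f x +_) (∑ᴸ-* c xs f)) (sym (*-distribˡ-+ c (f x) (∑ᴸ xs f)))

  ∑ᴸ-const : ∀ c (xs : List A) → ∑ᴸ xs (λ _ → c) ≡ ι (length xs) * c
  ∑ᴸ-const c []       = sym (*-zeroˡ c)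
  ∑ᴸ-const c (x ∷ xs) = trans (cong (c +_) (∑ᴸ-const c xs)) (ι-suc-* (length xs) c)

  length-filter-≤∑ᴸ : ∀ {P : A → Set} (P? : Decidable P) {xs : List A} {g : A → ℚ} →
    All (λ x → 0ℚ ≤ g x × (P x → 1ℚ ≤ g x)) xs → ι (length (filter P? xs)) ≤ ∑ᴸ xs g
  length-filter-≤∑ᴸ P? []                          = ≤-refl
  length-filter-≤∑ᴸ P? {x ∷ xs} {g} ((0≤gx , h) ∷ hs) with P? x
  ... | yes Px = ≤-trans (≤-reflexive (ι-suc (length (filter P? xs)))) (+-mono-≤ (h Px) (length-filter-≤∑ᴸ P? hs))
  ... | no  _  = ≤-trans (≤-reflexive (sym (+-identityˡ _))) (+-mono-≤ 0≤gx (length-filter-≤∑ᴸ P? hs))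

  length-filter-⊎ : ∀ {P Q R : A → Set} (P? : Decidable P) (Q? : Decidable Q) (R? : Decidable R) →
    (∀ {x} → P x → Q x ⊎ R x) → (xs : List A) →
    length (filter P? xs) ℕ.≤ length (filter Q? xs) ℕ.+ length (filter R? xs)
  length-filter-⊎ P? Q? R? h []       = ℕ.z≤n
  length-filter-⊎ P? Q? R? h (x ∷ xs) with P? x | Q? x | R? x | length-filter-⊎ P? Q? R? h xs
  ... | yes _ | yes _ | yes _ | ih = ℕ.s≤s (ℕ.≤-trans ih (ℕ.+-monoʳ-≤ _ (ℕ.n≤1+n _)))
  ... | yes _ | yes _ | no  _ | ih = ℕ.s≤s ih
  ... | yes _ | no  _ | yes _ | ih = ℕ.≤-trans (ℕ.s≤s ih) (ℕ.≤-reflexive (sym (ℕ.+-suc _ _)))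
  ... | yes p | no ¬q | no ¬r | _  with h p
  ... | inj₁ q = contradiction q ¬q
  ... | inj₂ r = contradiction r ¬r
  length-filter-⊎ P? Q? R? h (x ∷ xs) | no _ | yes _ | yes _ | ih = ℕ.m≤n⇒m≤1+n (ℕ.≤-trans ih (ℕ.+-monoʳ-≤ _ (ℕ.n≤1+n _)))
  length-filter-⊎ P? Q? R? h (x ∷ xs) | no _ | yes _ | no  _ | ih = ℕ.m≤n⇒m≤1+n ih
  length-filter-⊎ P? Q? R? h (x ∷ xs) | no _ | no  _ | yes _ | ih = ℕ.≤-trans ih (ℕ.+-monoʳ-≤ _ (ℕ.n≤1+n _))
  length-filter-⊎ P? Q? R? h (x ∷ xs) | no _ | no  _ | no  _ | ih = ih

mem : Fin n → Subset n → ℚ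
mem v f = bit (lookup f v)

mem-∈ : ∀ {v} {f : Subset n} → v ∈ f → mem v f ≡ 1ℚ
mem-∈ v∈f = cong bit ([]=⇒lookup v∈f)

mem-∉ : ∀ {v} {f : Subset n} → v ∉ f → mem v f ≡ 0ℚ
mem-∉ {v = v} {f} v∉f with lookup f v in eq
... | true  = contradiction (lookup⇒[]= v f eq) v∉f
... | false = refl

∑-mem : (f : Subset n) → ∑ (λ v → mem v f) ≡ ι ∣ f ∣
∑-mem []            = refl
∑-mem (inside  ∷ f) = trans (cong (1ℚ +_) (∑-mem f)) (sym (ι-suc ∣ f ∣))
∑-mem (outside ∷ f) = trans (+-identityˡ _) (∑-mem f)

degree-∑ᴸ : (es : List (Subset n)) (v : Fin n) → ι (length (filter (v ∈?_) es)) ≡ ∑ᴸ es (mem v)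
degree-∑ᴸ []       v = refl
degree-∑ᴸ (f ∷ es) v with v ∈? f
... | yes v∈f = trans (ι-suc (length (filter (v ∈?_) es))) (cong₂ _+_ (sym (mem-∈ v∈f)) (degree-∑ᴸ es v))
... | no  v∉f = trans (sym (+-identityˡ _)) (cong₂ _+_ (sym (mem-∉ v∉f)) (degree-∑ᴸ es v))

∑ᴸ-mem : ∀ {d} (H : Hypergraph n) → Regular d H → ∀ v → ∑ᴸ (edges H) (mem v) ≡ ι d
∑ᴸ-mem H regular v = trans (sym (degree-∑ᴸ (edges H) v)) (cong ι (regular v))

module _ {n r d : ℕ} (H : Hypergraph n) (uniform : Uniform r H) (regular : Regular d H) where

  -- Double counting of the incidences between vertices and edges.
  handshake : ι n * ι d ≡ ι r * ι (e H)
  handshake = begin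
    ι n * ι d                              ≡⟨ sym (∑-const n (ι d)) ⟩
    ∑ {n} (λ _ → ι d)                      ≡⟨ ∑-cong (λ v → sym (∑ᴸ-mem H regular v)) ⟩
    ∑ (λ v → ∑ᴸ (edges H) (mem v))         ≡⟨ ∑-∑ᴸ-swap (edges H) (λ f v → mem v f) ⟩
    ∑ᴸ (edges H) (λ f → ∑ (λ v → mem v f)) ≡⟨ ∑ᴸ-cong (All.map (λ {f} ∣f∣≡r → trans (∑-mem f) (cong ι ∣f∣≡r)) uniform) ⟩
    ∑ᴸ (edges H) (λ _ → ι r)               ≡⟨ ∑ᴸ-const (ι r) (edges H) ⟩
    ι (e H) * ι r                          ≡⟨ *-comm (ι (e H)) (ι r) ⟩
    ι r * ι (e H)                          ∎
    where open ≡-Reasoning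

-- The diagonal is not excluded: these are closed neighbourhoods.
adjacency : List (Subset n) → Fin n → Fin n → ℚ
adjacency []       v u = 0ℚ
adjacency (f ∷ es) v u = (mem v f * mem u f) ⊔ adjacency es v u

0≤mem*mem : ∀ v u (f : Subset n) → 0ℚ ≤ mem v f * mem u f
0≤mem*mem v u f = 0≤* (proj₁ (bit-isProb (lookup f v))) (proj₁ (bit-isProb (lookup f u)))

-- Taking a maximum over the edges, not a sum, keeps the weight at most 1 even when two vertices
-- share several edges.
adjacency-isProb : (es : List (Subset n)) → ∀ v u → 0ℚ ≤ adjacency es v u × adjacency es v u ≤ 1ℚ
adjacency-isProb []       v u = ≤-refl , 0≤1
adjacency-isProb (f ∷ es) v u = let 0≤w , w≤1 = adjacency-isProb es v u in
  ≤-trans 0≤w (p≤q⊔p (mem v f * mem u f) _) ,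
  ⊔-lub (*-mono {mem v f} {1ℚ} (proj₁ (bit-isProb (lookup f v))) 0≤1
    (proj₂ (bit-isProb (lookup f v))) (proj₂ (bit-isProb (lookup f u)))) w≤1

adjacency-sym : (es : List (Subset n)) → ∀ v u → adjacency es v u ≡ adjacency es u v
adjacency-sym []       v u = refl
adjacency-sym (f ∷ es) v u = cong₂ _⊔_ (*-comm (mem v f) (mem u f)) (adjacency-sym es v u)

adjacency-≤∑ᴸ : (es : List (Subset n)) → ∀ v u → adjacency es v u ≤ ∑ᴸ es (λ f → mem v f * mem u f)
adjacency-≤∑ᴸ []       v u = ≤-refl
adjacency-≤∑ᴸ (f ∷ es) v u = let w≤ = adjacency-≤∑ᴸ es v u in ⊔-lub
  {∑ᴸ (f ∷ es) (λ g → mem v g * mem u g)} {mem v f * mem u f} {adjacency es v u}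
  (≤-by (≤-trans (proj₁ (adjacency-isProb es v u)) w≤) refl)
  (≤-trans w≤ (≤-by (0≤mem*mem v u f) (+-comm (∑ᴸ es (λ g → mem v g * mem u g)) (mem v f * mem u f))))

adjacency-edge : ∀ {es : List (Subset n)} {f v u} → f ∈ᴸ es → v ∈ f → u ∈ f → adjacency es v u ≡ 1ℚ
adjacency-edge {es = es} {f} {v} {u} f∈es v∈f u∈f =
  ≤-antisym (proj₂ (adjacency-isProb es v u)) (≤-trans (≤-reflexive (sym (cong₂ _*_ (mem-∈ v∈f) (mem-∈ u∈f)))) (lower f∈es))
  where
  lower : ∀ {es} → f ∈ᴸ es → mem v f * mem u f ≤ adjacency es v u
  lower {g ∷ es} (here refl) = p≤p⊔q (mem v f * mem u f) (adjacency es v u)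
  lower {g ∷ es} (there h)   = ≤-trans (lower h) (p≤q⊔p (mem v g * mem u g) (adjacency es v u))

module _ {n r d : ℕ} (H : Hypergraph n) (uniform : Uniform r H) (regular : Regular d H) where

  -- A union bound: `v` lies in d edges, and each of them contributes r vertices.
  ∑-adjacency : ∀ v → ∑ (adjacency (edges H) v) ≤ ι r * ι d
  ∑-adjacency v = begin
    ∑ (adjacency (edges H) v)                              ≤⟨ ∑-mono (adjacency-≤∑ᴸ (edges H) v) ⟩
    ∑ (λ u → ∑ᴸ (edges H) (λ f → mem v f * mem u f))       ≡⟨ ∑-∑ᴸ-swap (edges H) (λ f u → mem v f * mem u f) ⟩
    ∑ᴸ (edges H) (λ f → ∑ (λ u → mem v f * mem u f))       ≡⟨ ∑ᴸ-cong (All.map (λ {f} eq → step f eq) uniform) ⟩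
    ∑ᴸ (edges H) (λ f → ι r * mem v f)                     ≡⟨ ∑ᴸ-* (ι r) (edges H) (mem v) ⟩
    ι r * ∑ᴸ (edges H) (mem v)                             ≡⟨ cong (ι r *_) (∑ᴸ-mem H regular v) ⟩
    ι r * ι d                                              ∎
    where
    open ≤-Reasoning
    step : ∀ f → ∣ f ∣ ≡ r → ∑ (λ u → mem v f * mem u f) ≡ ι r * mem v f
    step f eq = trans (∑-* (mem v f) (λ u → mem u f))
      (trans (cong (mem v f *_) (trans (∑-mem f) (cong ι eq))) (*-comm (mem v f) (ι r)))

-- Monochromatic edges

prod-isProb : (f : Subset n) {φ : Fin n → ℚ} → IsProb φ → 0ℚ ≤ prod f φ × prod f φ ≤ 1ℚ
prod-isProb []            P = 0≤1 , ≤-refl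
prod-isProb (inside  ∷ f) P = let lo , hi = prod-isProb f (P ∘ suc) in
  0≤* (proj₁ (P zero)) lo , *-mono (proj₁ (P zero)) 0≤1 (proj₂ (P zero)) hi
prod-isProb (outside ∷ f) P = prod-isProb f (P ∘ suc)

prod-zero : ∀ {f : Subset n} {v} {φ : Fin n → ℚ} → v ∈ f → φ v ≡ 0ℚ → prod f φ ≡ 0ℚ
prod-zero {f = inside ∷ f}  {φ = φ}     here        eq = trans (cong (_* prod f (φ ∘ suc)) eq) (*-zeroˡ (prod f (φ ∘ suc)))
prod-zero {f = inside ∷ f}  {φ = φ}     (there v∈f) eq = trans (cong (φ zero *_) (prod-zero v∈f eq)) (*-zeroʳ (φ zero))
prod-zero {f = outside ∷ f}             (there v∈f) eq = prod-zero v∈f eq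

-- For nonempty `f`, the indicator that `f` is monochromatic: the first product detects `f` inside
-- `x`, the second `f` inside the complement. As a sum of products it can be averaged by `E-prod`.
mono : Subset n → Cube n → ℚ
mono f x = prod f (bit ∘ lookup x) + prod f (bit ∘ not ∘ lookup x)

-- The colour of the first vertex of `f` kills one of the two products. For the empty set both would
-- equal 1.
mono≤1 : (f : Subset n) → 1 ℕ.≤ ∣ f ∣ → ∀ x → mono f x ≤ 1ℚ
mono≤1 (inside ∷ f) 1≤ (true ∷ x) = ≤-trans
  (≤-reflexive (eq (prod f (bit ∘ lookup x)) (prod f (bit ∘ not ∘ lookup x))))
  (proj₂ (prod-isProb f (bit-isProb ∘ lookup x)))
  where
  eq : ∀ s t → 1ℚ * s + 0ℚ * t ≡ s
  eq = solve-∀ ring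
mono≤1 (inside ∷ f) 1≤ (false ∷ x) = ≤-trans
  (≤-reflexive (eq (prod f (bit ∘ lookup x)) (prod f (bit ∘ not ∘ lookup x))))
  (proj₂ (prod-isProb f (bit-isProb ∘ not ∘ lookup x)))
  where
  eq : ∀ s t → 0ℚ * s + 1ℚ * t ≡ t
  eq = solve-∀ ring
mono≤1 (outside ∷ f) 1≤ (_ ∷ x) = mono≤1 f 1≤ x

crosses⇒mono≡0 : ∀ (f x : Subset n) → Crosses x f → mono f x ≡ 0ℚ
crosses⇒mono≡0 f x ((u , u∈) , (v , v∈)) =
  cong₂ _+_
    (prod-zero (proj₁ v∈f∩) (mem-∉ (x∈∁p⇒x∉p (proj₂ v∈f∩))))
    (prod-zero (proj₁ u∈f∩) (cong (bit ∘ not) ([]=⇒lookup (proj₂ u∈f∩))))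
  where
  v∈f∩ = x∈p∩q⁻ f (∁ x) v∈
  u∈f∩ = x∈p∩q⁻ f x u∈

cutSize-≤ : ∀ {r} (H : Hypergraph n) → 1 ℕ.≤ r → Uniform r H → ∀ x →
  ι (cutSize H x) ≤ ι (e H) - ∑ᴸ (edges H) (λ f → mono f x)
cutSize-≤ H 1≤r uniform x = ≤-trans
  (length-filter-≤∑ᴸ (crosses? x) {xs = edges H} {g = λ f → 1ℚ + - 1ℚ * mono f x}
    (All.map (λ {f} ∣f∣≡r →
      ≤-by (a≤b⇒0≤b-a (mono≤1 f (subst (1 ℕ.≤_) (sym ∣f∣≡r) 1≤r) x)) (eq₁ (mono f x)) ,
      λ cr → ≤-by ≤-refl (eq₂ (crosses⇒mono≡0 f x cr)))
      uniform))
  (≤-reflexive (sum (edges H)))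
  where
  eq₁ : ∀ m → 0ℚ + (1ℚ - m) ≡ 1ℚ + - 1ℚ * m
  eq₁ = solve-∀ ring
  eq₂ : ∀ {m} → m ≡ 0ℚ → 1ℚ + 0ℚ ≡ 1ℚ + - 1ℚ * m
  eq₂ refl = refl
  eq₃ : ∀ s t m → (1ℚ + - 1ℚ * m) + (s - t) ≡ (1ℚ + s) - (m + t)
  eq₃ = solve-∀ ring
  sum : ∀ es → ∑ᴸ es (λ f → 1ℚ + - 1ℚ * mono f x) ≡ ι (length es) - ∑ᴸ es (λ f → mono f x)
  sum []       = refl
  sum (f ∷ es) = trans (cong (1ℚ + - 1ℚ * mono f x +_) (sum es))
    (trans (eq₃ (ι (length es)) (∑ᴸ es (λ f → mono f x)) (mono f x))
      (cong (_- (mono f x + ∑ᴸ es (λ f → mono f x))) (sym (ι-suc (length es)))))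

-- Rebalancing a partition

∩-[]≔ : ∀ {f : Subset n} {v} → v ∉ f → ∀ b X → f ∩ (X [ v ]≔ b) ≡ f ∩ X
∩-[]≔ {f = inside  ∷ f} {zero}  v∉f b X       = contradiction here v∉f
∩-[]≔ {f = outside ∷ f} {zero}  v∉f b (_ ∷ X) = refl
∩-[]≔ {f = s ∷ f}       {suc v} v∉f b (_ ∷ X) = cong (_ ∷_) (∩-[]≔ (v∉f ∘ there) b X)

-- An edge avoiding `v` does not see the change, so recolouring one vertex creates at most
-- `degree H v` new crossings.
crosses-[]≔ : ∀ {X f : Subset n} v b → Crosses (X [ v ]≔ b) f → Crosses X f ⊎ v ∈ f
crosses-[]≔ {X = X} {f} v b (ne , ne′) with v ∈? f
... | yes v∈f = inj₂ v∈f
... | no  v∉f = inj₁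
  ( subst (Nonempty) (∩-[]≔ v∉f b X) ne
  , subst (Nonempty) (trans (cong (f ∩_) (map-[]≔ not X v)) (∩-[]≔ v∉f (not b) (∁ X))) ne′ )

cutSize-[]≔ : (H : Hypergraph n) → ∀ X v b → cutSize H (X [ v ]≔ b) ℕ.≤ cutSize H X ℕ.+ degree H v
cutSize-[]≔ H X v b = length-filter-⊎ (crosses? (X [ v ]≔ b)) (crosses? X) (v ∈?_) (crosses-[]≔ v b) (edges H)

∁-involutive : (X : Subset n) → ∁ (∁ X) ≡ X
∁-involutive []      = refl
∁-involutive (b ∷ X) = cong₂ _∷_ (not-involutive b) (∁-involutive X)

cutSize-∁ : (H : Hypergraph n) → ∀ X → cutSize H (∁ X) ≡ cutSize H X
cutSize-∁ H X = cong length (filter-≐ (crosses? (∁ X)) (crosses? X) (to , from) (edges H))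
  where
  to : ∀ {f} → Crosses (∁ X) f → Crosses X f
  to {f} (ne , ne′) = subst (λ Y → Nonempty (f ∩ Y)) (∁-involutive X) ne′ , ne
  from : ∀ {f} → Crosses X f → Crosses (∁ X) f
  from {f} (ne , ne′) = ne′ , subst (λ Y → Nonempty (f ∩ Y)) (sym (∁-involutive X)) ne

remove-vertex : ∀ (X : Subset n) {m} → ∣ X ∣ ≡ suc m →
  ∃ λ v → ∣ X [ v ]≔ outside ∣ ≡ m × ∣ ∁ (X [ v ]≔ outside) ∣ ≡ suc ∣ ∁ X ∣
remove-vertex (inside  ∷ X) eq = zero , ℕ.suc-injective eq , refl
remove-vertex (outside ∷ X) eq with remove-vertex X eq
... | v , eq₁ , eq₂ = suc v , eq₁ , cong suc eq₂

-- Moving one vertex out of the larger part lowers the surplus `k` by two and costs at most `d`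
-- edges. The recursion therefore ends at surplus 0 or 1, both of which an equipartition allows.
-- Charging `d` per unit of surplus is generous by a factor of two.
rebalance⁺ : ∀ {d} (H : Hypergraph n) → Regular d H → ∀ k X → ∣ X ∣ ≡ ∣ ∁ X ∣ ℕ.+ k →
  ∃ λ X′ → Equipartition X′ × cutSize H X′ ℕ.≤ cutSize H X ℕ.+ d ℕ.* k
rebalance⁺ H reg zero X eq =
  X , ℕ.≤-trans (ℕ.≤-reflexive (ℕ.m≡n⇒∣m-n∣≡0 (trans eq (ℕ.+-identityʳ _)))) ℕ.z≤n , ℕ.m≤m+n _ _
rebalance⁺ H reg (suc zero) X eq =
  X , ℕ.≤-reflexive (trans (cong (ℕ.∣_- ∣ ∁ X ∣ ∣) eq) (trans (ℕ.∣-∣-comm (∣ ∁ X ∣ ℕ.+ 1) ∣ ∁ X ∣) (ℕ.∣m-m+n∣≡n ∣ ∁ X ∣ 1))) , ℕ.m≤m+n _ _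
rebalance⁺ {d = d} H reg (suc (suc k)) X eq
  with remove-vertex X {∣ ∁ X ∣ ℕ.+ suc k} (trans eq (ℕ.+-suc _ _))
... | v , eq₁ , eq₂ with rebalance⁺ H reg k (X [ v ]≔ outside) (trans eq₁ (trans (ℕ.+-suc _ _) (cong (ℕ._+ k) (sym eq₂))))
... | X′ , equi , cut≤ = X′ , equi , (begin
  cutSize H X′                                            ≤⟨ cut≤ ⟩
  cutSize H (X [ v ]≔ outside) ℕ.+ d ℕ.* k                ≤⟨ ℕ.+-monoˡ-≤ (d ℕ.* k) (cutSize-[]≔ H X v outside) ⟩
  cutSize H X ℕ.+ degree H v ℕ.+ d ℕ.* k                  ≡⟨ cong (λ m → cutSize H X ℕ.+ m ℕ.+ d ℕ.* k) (reg v) ⟩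
  cutSize H X ℕ.+ d ℕ.+ d ℕ.* k                           ≡⟨ ℕ.+-assoc (cutSize H X) d (d ℕ.* k) ⟩
  cutSize H X ℕ.+ (d ℕ.+ d ℕ.* k)                         ≡⟨ cong (cutSize H X ℕ.+_) (sym (ℕ.*-suc d k)) ⟩
  cutSize H X ℕ.+ d ℕ.* suc k                             ≤⟨ ℕ.+-monoʳ-≤ (cutSize H X) (ℕ.*-monoʳ-≤ d (ℕ.n≤1+n (suc k))) ⟩
  cutSize H X ℕ.+ d ℕ.* suc (suc k)                       ∎)
  where open ℕ.≤-Reasoning

imbalance-∣∣ : (x : Cube n) → imbalance x ≡ ι (∣ x ∣) - ι (∣ ∁ x ∣)
imbalance-∣∣ []          = refl
imbalance-∣∣ (true ∷ x)  = trans (cong (1ℚ +_) (imbalance-∣∣ x))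
  (trans (sym (+-assoc 1ℚ (ι ∣ x ∣) (- ι (∣ ∁ x ∣)))) (cong (_- ι (∣ ∁ x ∣)) (sym (ι-suc ∣ x ∣))))
imbalance-∣∣ (false ∷ x) = trans (cong (- 1ℚ +_) (imbalance-∣∣ x))
  (trans (eq (ι ∣ x ∣) (ι ∣ ∁ x ∣)) (cong (λ y → ι (∣ x ∣) - y) (sym (ι-suc ∣ ∁ x ∣))))
  where
  eq : ∀ s t → - 1ℚ + (s - t) ≡ s - (1ℚ + t)
  eq = solve-∀ ring

imbalance-ι : ∀ {k} (x : Cube n) → ∣ x ∣ ≡ ∣ ∁ x ∣ ℕ.+ k → imbalance x ≡ ι k
imbalance-ι {k = k} x eq = trans (imbalance-∣∣ x)
  (trans (cong (_- ι (∣ ∁ x ∣)) (trans (cong ι eq) (ι-+ ∣ ∁ x ∣ k))) (a+b-a≡b (ι ∣ ∁ x ∣) (ι k)))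

imbalance-∁ : (x : Cube n) → imbalance (∁ x) ≡ - imbalance x
imbalance-∁ []      = refl
imbalance-∁ (b ∷ x) = trans (cong₂ _+_ (sgn-not b) (imbalance-∁ x)) (sym (neg-distrib-+ (sgn b) (imbalance x)))

-- The cut is symmetric under complement, so the larger part may be taken to be `X`. The surplus is
-- recorded through its square, which hides the sign of the imbalance and is the quantity whose mean
-- is controlled.
rebalance : ∀ {d} (H : Hypergraph n) → Regular d H → ∀ X →
  ∃[ X′ ] ∃[ k ] Equipartition X′ × cutSize H X′ ℕ.≤ cutSize H X ℕ.+ d ℕ.* k × ι k * ι k ≡ imbalance X * imbalance X
rebalance {d = d} H reg X with ℕ.≤-total ∣ ∁ X ∣ ∣ X ∣
... | inj₁ le with ℕ.m≤n⇒∃[o]m+o≡n le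
... | k , eq with rebalance⁺ H reg k X (sym eq)
... | X′ , equi , cut≤ = X′ , k , equi , cut≤ , cong (λ y → y * y) (sym (imbalance-ι X (sym eq)))
rebalance {d = d} H reg X | inj₂ le with ℕ.m≤n⇒∃[o]m+o≡n le
... | k , eq = let eq′ = trans (sym eq) (cong (λ Y → ∣ Y ∣ ℕ.+ k) (sym (∁-involutive X)))
                   X′ , equi , cut≤ = rebalance⁺ H reg k (∁ X) eq′ in
  X′ , k , equi , ℕ.≤-trans cut≤ (ℕ.+-monoˡ-≤ (d ℕ.* k) (ℕ.≤-reflexive (cutSize-∁ H X))) ,
  trans (cong (λ y → y * y) (trans (sym (imbalance-ι (∁ X) eq′)) (imbalance-∁ X))) (neg*neg (imbalance X))

-- Products over an edge of increasing functions

1/[2*m] : ∀ m .{{_ : ℕ.NonZero m}} .{{_ : ℕ.NonZero (2 ℕ.* m)}} → ℤ.+ 1 / (2 ℕ.* m) ≡ ½ * (ℤ.+ 1 / m)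
1/[2*m] (suc m) = toℚᵘ-injective (begin
  toℚᵘ (ℤ.+ 1 / (2 ℕ.* suc m))         ≈⟨ toℚᵘ-fromℚᵘ (ℤ.+ 1 ℚᵘ./ (2 ℕ.* suc m)) ⟩
  ℤ.+ 1 ℚᵘ./ (2 ℕ.* suc m)             ≈⟨ ℚᵘ.*≡* refl ⟩
  ℚᵘ.½ ℚᵘ.* (ℤ.+ 1 ℚᵘ./ suc m)         ≈⟨ ℚᵘ.*-congˡ {ℚᵘ.½} (ℚᵘ.≃-sym (toℚᵘ-fromℚᵘ (ℤ.+ 1 ℚᵘ./ suc m))) ⟩
  ℚᵘ.½ ℚᵘ.* toℚᵘ (ℤ.+ 1 / suc m)       ≈⟨ ℚᵘ.≃-sym (toℚᵘ-homo-* ½ (ℤ.+ 1 / suc m)) ⟩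
  toℚᵘ (½ * (ℤ.+ 1 / suc m))           ∎)
  where open ℚᵘ.≃-Reasoning

1/2^-suc : ∀ m → 1/2^ (suc m) ≡ ½ * 1/2^ m
1/2^-suc m = 1/[2*m] (2 ℕ.^ m) {{ℕ.m^n≢0 2 m}} {{ℕ.m^n≢0 2 (suc m)}}

0≤1/2^ : ∀ m → 0ℚ ≤ 1/2^ m
0≤1/2^ zero    = ≤ᵇ⇒≤ _
0≤1/2^ (suc m) = ≤-trans (0≤* 0≤½ (0≤1/2^ m)) (≤-reflexive (sym (1/2^-suc m)))

record Fair (F : Cube n → ℚ) : Set where
  field
    nonneg   : ∀ z → 0ℚ ≤ F z
    monotone : Monotone F
    mean-½   : U F ≡ ½

open Fair

-- `G` accumulates the factors already absorbed. It stays nonnegative and increasing, so each use of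
-- `harris` splits off one more factor of mean 1/2.
harris-prod : (f : Subset k) {φ : Fin k → Cube n → ℚ} → (∀ i → Fair (φ i)) →
  (G : Cube n → ℚ) → (∀ z → 0ℚ ≤ G z) → Monotone G →
  U G * 1/2^ ∣ f ∣ ≤ U (λ z → G z * prod f (λ i → φ i z))
harris-prod [] fair G 0≤G mG = ≤-reflexive (trans (*-identityʳ (U G)) (E-cong coin (λ z → sym (*-identityʳ (G z)))))
harris-prod (inside ∷ f) {φ} fair G 0≤G mG = begin
  U G * 1/2^ (suc ∣ f ∣)                                   ≡⟨ cong (U G *_) (1/2^-suc ∣ f ∣) ⟩
  U G * (½ * 1/2^ ∣ f ∣)                                   ≡⟨ sym (*-assoc (U G) ½ (1/2^ ∣ f ∣)) ⟩
  U G * ½ * 1/2^ ∣ f ∣                                     ≡⟨ cong (λ s → U G * s * 1/2^ ∣ f ∣) (sym (mean-½ (fair zero))) ⟩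
  U G * U (φ zero) * 1/2^ ∣ f ∣
    ≤⟨ *-monoʳ-≤-nonNeg (1/2^ ∣ f ∣) {{nonNegative (0≤1/2^ ∣ f ∣)}} (harris G (φ zero) mG (monotone (fair zero))) ⟩
  U (λ z → G z * φ zero z) * 1/2^ ∣ f ∣
    ≤⟨ harris-prod f (fair ∘ suc) (λ z → G z * φ zero z) (λ z → 0≤* (0≤G z) (nonneg (fair zero) z))
         (Monotone-* 0≤G (nonneg (fair zero)) mG (monotone (fair zero))) ⟩
  U (λ z → G z * φ zero z * prod f (λ i → φ (suc i) z))    ≡⟨ E-cong coin (λ z → *-assoc (G z) (φ zero z) (prod f (λ i → φ (suc i) z))) ⟩
  U (λ z → G z * (φ zero z * prod f (λ i → φ (suc i) z)))  ∎
  where open ≤-Reasoning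
harris-prod (outside ∷ f) fair G 0≤G mG = harris-prod f (fair ∘ suc) G 0≤G mG

-- In the application `G` is the factor of the first vertex of an edge. It is multiplied by the
-- factor of the next vertex before `harris-prod` is applied, so the pair contributes its true
-- correlation and the other `m` factors 1/2 each.
prod-gain₁ : ∀ (f : Subset k) {m κ} {φ : Fin k → Cube n → ℚ} → ∣ f ∣ ≡ suc m → (∀ i → Fair (φ i)) →
  (G : Cube n → ℚ) → (∀ z → 0ℚ ≤ G z) → Monotone G →
  (∀ {v} → v ∈ f → κ ≤ U (λ z → G z * φ v z)) →
  κ * 1/2^ m ≤ U (λ z → G z * prod f (λ i → φ i z))
prod-gain₁ (inside ∷ f) {κ = κ} {φ} refl fair G 0≤G mG κ≤ = begin
  κ * 1/2^ ∣ f ∣                                           ≤⟨ *-monoʳ-≤-nonNeg (1/2^ ∣ f ∣) {{nonNegative (0≤1/2^ ∣ f ∣)}} (κ≤ here) ⟩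
  U (λ z → G z * φ zero z) * 1/2^ ∣ f ∣
    ≤⟨ harris-prod f (fair ∘ suc) (λ z → G z * φ zero z) (λ z → 0≤* (0≤G z) (nonneg (fair zero) z))
         (Monotone-* 0≤G (nonneg (fair zero)) mG (monotone (fair zero))) ⟩
  U (λ z → G z * φ zero z * prod f (λ i → φ (suc i) z))    ≡⟨ E-cong coin (λ z → *-assoc (G z) (φ zero z) (prod f (λ i → φ (suc i) z))) ⟩
  U (λ z → G z * (φ zero z * prod f (λ i → φ (suc i) z)))  ∎
  where open ≤-Reasoning
prod-gain₁ (outside ∷ f) eq fair G 0≤G mG κ≤ = prod-gain₁ f eq (fair ∘ suc) G 0≤G mG (κ≤ ∘ there)

prod-gain : ∀ (f : Subset k) {m κ} {φ : Fin k → Cube n → ℚ} → ∣ f ∣ ≡ suc (suc m) → (∀ i → Fair (φ i)) →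
  (∀ {u v} → u ∈ f → v ∈ f → κ ≤ U (λ z → φ u z * φ v z)) →
  κ * 1/2^ m ≤ U (λ z → prod f (λ i → φ i z))
prod-gain (inside ∷ f) {φ = φ} eq fair κ≤ =
  prod-gain₁ f (ℕ.suc-injective eq) (fair ∘ suc) (φ zero) (nonneg (fair zero)) (monotone (fair zero)) (λ v∈f → κ≤ here (there v∈f))
prod-gain (outside ∷ f) eq fair κ≤ = prod-gain f eq (fair ∘ suc) (λ u∈f v∈f → κ≤ (there u∈f) (there v∈f))

-- Linear forms on the cube

linear : (Fin n → ℚ) → Cube n → ℚ
linear w z = ∑ (λ u → w u * sgn (lookup z u))

linear-[]≔ : ∀ (w : Fin n → ℚ) z i b → linear w (z [ i ]≔ b) ≡ linear w z + w i * (sgn b - sgn (lookup z i))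
linear-[]≔ w (b₀ ∷ z) zero b = eq (w zero) (sgn b) (sgn b₀) (linear (w ∘ suc) z)
  where
  eq : ∀ w s s₀ l → w * s + l ≡ (w * s₀ + l) + w * (s - s₀)
  eq = solve-∀ ring
linear-[]≔ w (b₀ ∷ z) (suc i) b = trans (cong (w zero * sgn b₀ +_) (linear-[]≔ (w ∘ suc) z i b))
  (sym (+-assoc (w zero * sgn b₀) (linear (w ∘ suc) z) (w (suc i) * (sgn b - sgn (lookup z i)))))

linear-diff : ∀ (w : Fin n → ℚ) z i → linear w (z [ i ]≔ true) ≡ linear w (z [ i ]≔ false) + (w i + w i)
linear-diff w z i = trans (linear-[]≔ w z i true)
  (trans (eq (linear w z) (w i) (sgn (lookup z i))) (cong (_+ (w i + w i)) (sym (linear-[]≔ w z i false))))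
  where
  eq : ∀ l w s → l + w * (1ℚ - s) ≡ (l + w * (- 1ℚ - s)) + (w + w)
  eq = solve-∀ ring

linear-monotone : {w : Fin n → ℚ} → (∀ i → 0ℚ ≤ w i) → Monotone (linear w)
linear-monotone {w = w} 0≤w z i = ≤-by (0≤+ (0≤w i) (0≤w i)) (sym (linear-diff w z i))

sgn-negate : ∀ (z : Cube n) i → sgn (lookup (negate z) i) ≡ - sgn (lookup z i)
sgn-negate z i = trans (cong sgn (lookup-map i not z)) (sgn-not (lookup z i))

linear-odd : (w : Fin n → ℚ) → Odd (linear w)
linear-odd w z = trans (∑-cong (λ u → trans (cong (w u *_) (sgn-negate z u)) (sym (neg-distribʳ-* (w u) (sgn (lookup z u))))))
  (∑-neg (λ u → w u * sgn (lookup z u)))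

sgn-monotone : (v : Fin n) → Monotone (λ z → sgn (lookup z v))
sgn-monotone zero    (_ ∷ z) zero    = -1≤1
sgn-monotone zero    (_ ∷ z) (suc i) = ≤-refl
sgn-monotone (suc v) (_ ∷ z) zero    = ≤-refl
sgn-monotone (suc v) (_ ∷ z) (suc i) = sgn-monotone v z i

-- The form is odd, hence has mean zero, and its increments are 2 `w i`. Efron-Stein then bounds the
-- second moment by the sum of the squared weights, and weights in [0, 1] dominate their squares.
linear-second-moment : {w : Fin n → ℚ} → IsProb w → U (λ z → linear w z * linear w z) ≤ ∑ w
linear-second-moment {w = w} P = begin
  U (λ z → linear w z * linear w z)
    ≤⟨ efron-stein (linear w) (λ i → w i + w i) (linear-monotone (proj₁ ∘ P)) (λ z i → ≤-reflexive (linear-diff w z i)) ⟩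
  U (linear w) * U (linear w) + ½ * ½ * ∑ (λ i → (w i + w i) * (w i + w i))
    ≡⟨ cong₂ (λ s t → s * s + t) (U-odd (linear-odd w)) (sym (∑-* (½ * ½) (λ i → (w i + w i) * (w i + w i)))) ⟩
  0ℚ * 0ℚ + ∑ (λ i → ½ * ½ * ((w i + w i) * (w i + w i)))
    ≡⟨ +-identityˡ (∑ (λ i → ½ * ½ * ((w i + w i) * (w i + w i)))) ⟩
  ∑ (λ i → ½ * ½ * ((w i + w i) * (w i + w i)))
    ≤⟨ ∑-mono (λ i → ≤-by (0≤* (proj₁ (P i)) (a≤b⇒0≤b-a (proj₂ (P i)))) (eq (w i))) ⟩
  ∑ w ∎
  where
  open ≤-Reasoning
  eq : ∀ w → ½ * ½ * ((w + w) * (w + w)) + w * (1ℚ - w) ≡ w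
  eq = solve-∀ ring

0≤mem : ∀ v (f : Subset n) → 0ℚ ≤ mem v f
0≤mem v f = proj₁ (bit-isProb (lookup f v))

-- The increment is 2 if v = i and 0 otherwise. Membership in a singleton expresses this in a form
-- that `∑-mem` can sum over `v`.
sgn-lipschitz : ∀ (v : Fin n) z i →
  sgn (lookup (z [ i ]≔ true) v) ≤ sgn (lookup (z [ i ]≔ false) v) + (mem v ⁅ i ⁆ + mem v ⁅ i ⁆)
sgn-lipschitz zero    (_ ∷ z) zero    = ≤-refl
sgn-lipschitz zero    (b ∷ z) (suc i) = ≤-reflexive (sym (+-identityʳ (sgn b)))
sgn-lipschitz (suc v) (_ ∷ z) zero    = ≤-by (0≤+ (0≤mem (suc v) ⁅ zero ⁆) (0≤mem (suc v) ⁅ zero ⁆)) refl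
sgn-lipschitz (suc v) (_ ∷ z) (suc i) = sgn-lipschitz v z i

*-antimonoˡ : 0ℚ ≤ c → a ≤ b → - c * b ≤ - c * a
*-antimonoˡ {c} {a} {b} 0≤c a≤b = ≤-by (0≤* 0≤c (a≤b⇒0≤b-a a≤b)) (eq a b c)
  where
  eq : ∀ a b c → - c * b + c * (b - a) ≡ - c * a
  eq = solve-∀ ring

U-+³ : (F₁ F₂ F₃ F₄ : Cube n → ℚ) →
  U (λ z → F₁ z + (F₂ z + (F₃ z + F₄ z))) ≡ U F₁ + (U F₂ + (U F₃ + U F₄))
U-+³ {n} F₁ F₂ F₃ F₄ = trans (E-+ {n} coin F₁ (λ z → F₂ z + (F₃ z + F₄ z)))
  (cong (U F₁ +_) (trans (E-+ {n} coin F₂ (λ z → F₃ z + F₄ z)) (cong (U F₂ +_) (E-+ {n} coin F₃ F₄))))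

-- The random colouring

module Colouring {n : ℕ} (w : Fin n → Fin n → ℚ) (w-isProb : ∀ v u → 0ℚ ≤ w v u × w v u ≤ 1ℚ)
  (w-sym : ∀ v u → w v u ≡ w u v) (R : ℚ) (∑w≤R : ∀ v → ∑ (w v) ≤ R)
  (h : ℚ) (0≤h : 0ℚ ≤ h) (h≤½ : h ≤ ½)
  -- The neighbourhood sums have second moment at most `R`, so 16 h² (R + 1) ≤ 1 keeps their
  -- multiples by `h` small in mean square.
  (h-small : (h + h + (h + h)) * (h + h + (h + h)) * (R + 1ℚ) ≤ 1ℚ) where

  S C α p : Fin n → Cube n → ℚ
  S v z = linear (w v) z
  C v z = clamp (h * S v z)
  α v z = ½ * sgn (lookup z v) + ½ * C v z
  p v z = ½ + ½ * α v z

  C-monotone : ∀ v → Monotone (C v)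
  C-monotone v z i = clamp-mono {h * S v (z [ i ]≔ false)} {h * S v (z [ i ]≔ true)}
    (*-monoˡ 0≤h (linear-monotone (proj₁ ∘ w-isProb v) z i))

  C-odd : ∀ v → Odd (C v)
  C-odd v z = trans (cong clamp (trans (cong (h *_) (linear-odd (w v) z)) (sym (neg-distribʳ-* h (S v z))))) (clamp-odd (h * S v z))

  α-odd : ∀ v → Odd (α v)
  α-odd v z = trans (cong₂ (λ s t → ½ * s + ½ * t) (sgn-negate z v) (C-odd v z)) (eq (sgn (lookup z v)) (C v z))
    where
    eq : ∀ s t → ½ * - s + ½ * - t ≡ - (½ * s + ½ * t)
    eq = solve-∀ ring

  α-monotone : ∀ v → Monotone (α v)
  α-monotone v z i = +-mono-≤ (*-monoˡ 0≤½ (sgn-monotone v z i)) (*-monoˡ 0≤½ (C-monotone v z i))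

  -1≤sgn : ∀ b → - 1ℚ ≤ sgn b
  -1≤sgn true  = -1≤1
  -1≤sgn false = ≤-refl

  sgn≤1 : ∀ b → sgn b ≤ 1ℚ
  sgn≤1 true  = ≤-refl
  sgn≤1 false = -1≤1

  p-isProb : ∀ z → IsProb (λ v → p v z)
  p-isProb z v =
    +-monoʳ-≤ ½ (*-monoˡ 0≤½ (+-mono-≤ (*-monoˡ 0≤½ (-1≤sgn (lookup z v))) (*-monoˡ 0≤½ (-1≤clamp (h * S v z))))) ,
    +-monoʳ-≤ ½ (*-monoˡ 0≤½ (+-mono-≤ (*-monoˡ 0≤½ (sgn≤1 (lookup z v))) (*-monoˡ 0≤½ (clamp≤1 (h * S v z)))))

  U-α : ∀ v → U (α v) ≡ 0ℚ
  U-α v = U-odd (α-odd v)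

  p-fair : ∀ v → Fair (p v)
  p-fair v = record
    { nonneg   = λ z → proj₁ (p-isProb z v)
    ; monotone = λ z i → +-monoʳ-≤ ½ (*-monoˡ 0≤½ (α-monotone v z i))
    ; mean-½   = trans (E-+ coin (λ _ → ½) (λ z → ½ * α v z))
        (cong₂ _+_ (E-const {n} coin ½) (trans (E-* coin ½ (α v)) (cong (½ *_) (U-α v))))
    }

  p-negate : ∀ v z → p v (negate z) ≡ 1ℚ - p v z
  p-negate v z = trans (cong (λ s → ½ + ½ * s) (α-odd v z)) (eq (α v z))
    where
    eq : ∀ s → ½ + ½ * - s ≡ 1ℚ - (½ + ½ * s)
    eq = solve-∀ ring

  -- Flipping z_t moves S v by two, and typically C v by 2h since h S v is bounded in mean square.
  U-sgn-C : ∀ {t v} → w v t ≡ 1ℚ → ½ * h ≤ U (λ z → sgn (lookup z t) * C v z)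
  U-sgn-C {t} {v} wvt≡1 = begin
    ½ * h
      ≤⟨ *-monoˡ {½} {h} 0≤½ (≤-by {h * (1ℚ - Q * (U (λ z → S v z * S v z) + 1ℚ))}
           (0≤* 0≤h (a≤b⇒0≤b-a (≤-trans (*-monoˡ (0≤a² (h + h + (h + h))) (+-monoˡ-≤ 1ℚ second)) h-small)))
           (eq₁ h (U (λ z → S v z * S v z)))) ⟩
    ½ * (K + M * U (λ z → S v z * S v z))
      ≡⟨ cong (½ *_) (sym (trans (E-+ coin (λ _ → K) (λ z → M * (S v z * S v z)))
           (cong₂ _+_ (E-const {n} coin K) (E-* coin M (λ z → S v z * S v z))))) ⟩
    ½ * U (λ z → K + M * (S v z * S v z))
      ≤⟨ *-monoˡ 0≤½ (U-mono pointwise) ⟩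
    ½ * U (λ z → C v (z [ t ]≔ true) - C v (z [ t ]≔ false))
      ≡⟨ sym (U-influence t (C v)) ⟩
    U (λ z → sgn (lookup z t) * C v z) ∎
    where
    open ≤-Reasoning
    second : U (λ z → S v z * S v z) ≤ R
    second = ≤-trans (linear-second-moment (w-isProb v)) (∑w≤R v)
    Q = (h + h + (h + h)) * (h + h + (h + h))
    -- With these constants K + M S² equals 2h (1 - 8h² (S² + 1)). It bounds from below the gain 2h
    -- (1 - (2y)²) at y = h (S - z_t), because (S - z_t)² ≤ 2 S² + 2.
    M = - ((h + h) * ((h + h) * (h + h) * (1ℚ + 1ℚ)))
    K = (h + h) + M
    eq₁ : ∀ h s → h + h * (1ℚ - (h + h + (h + h)) * (h + h + (h + h)) * (s + 1ℚ))
      ≡ (h + h) + - ((h + h) * ((h + h) * (h + h) * (1ℚ + 1ℚ))) + - ((h + h) * ((h + h) * (h + h) * (1ℚ + 1ℚ))) * s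
    eq₁ = solve-∀ ring
    eq₂ : ∀ h l s → h * (l + 1ℚ * (1ℚ - s)) ≡ h * (l - s) + h
    eq₂ = solve-∀ ring
    eq₃ : ∀ h l s → h * (l + 1ℚ * (- 1ℚ - s)) ≡ h * (l - s) - h
    eq₃ = solve-∀ ring
    eq₄ : ∀ h l s → (h + h) + - ((h + h) * ((h + h) * (h + h) * (1ℚ + 1ℚ))) + - ((h + h) * ((h + h) * (h + h) * (1ℚ + 1ℚ))) * (l * l)
      + (h + h) * ((h + h) * (h + h) * ((l + s) * (l + s) + (1ℚ + 1ℚ) * (1ℚ - s * s)))
      ≡ (h + h) * (1ℚ - (h * (l - s) + h * (l - s)) * (h * (l - s) + h * (l - s)))
    eq₄ = solve-∀ ring
    0≤1-sgn² : ∀ b → 0ℚ ≤ 1ℚ - sgn b * sgn b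
    0≤1-sgn² true  = ≤-refl
    0≤1-sgn² false = ≤-refl
    pointwise : ∀ z → K + M * (S v z * S v z) ≤ C v (z [ t ]≔ true) - C v (z [ t ]≔ false)
    pointwise z = begin
      K + M * (l * l)
        ≤⟨ ≤-by (0≤* (0≤+ 0≤h 0≤h) (0≤* (0≤a² (h + h)) (0≤+ (0≤a² (l + x)) (0≤* {1ℚ + 1ℚ} (≤ᵇ⇒≤ _) (0≤1-sgn² (lookup z t)))))) (eq₄ h l x) ⟩
      gain
        ≡⟨ sym (a+b-a≡b (clamp (y - h)) gain) ⟩
      clamp (y - h) + gain - clamp (y - h)
        ≤⟨ +-monoˡ-≤ (- clamp (y - h)) (clamp-gain y 0≤h h≤½) ⟩
      clamp (y + h) - clamp (y - h)
        ≡⟨ sym (cong₂ (λ s t → clamp s - clamp t) (shift true (eq₂ h l x)) (shift false (eq₃ h l x))) ⟩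
      C v (z [ t ]≔ true) - C v (z [ t ]≔ false) ∎
      where
      l = S v z
      x = sgn (lookup z t)
      -- The contribution of `t` itself is removed, so the two values of z_t give `y + h` and
      -- `y - h`.
      y = h * (l - x)
      gain = (h + h) * (1ℚ - (y + y) * (y + y))
      shift : ∀ b {y} → h * (l + 1ℚ * (sgn b - x)) ≡ y → h * S v (z [ t ]≔ b) ≡ y
      shift b eq = trans (cong (h *_) (trans (linear-[]≔ (w v) z t b) (cong (λ q → l + q * (sgn b - x)) wvt≡1))) eq

  -- The product expands into four correlations of odd increasing functions, each nonnegative by
  -- `harris`. The one between the sign at `s` and the clamped sum at `t` supplies the gain.
  U-α*α : ∀ {s t} → w s t ≡ 1ℚ → ½ * ½ * (½ * h) ≤ U (λ z → α s z * α t z)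
  U-α*α {s} {t} wst≡1 = begin
    ½ * ½ * (½ * h)
      ≤⟨ *-monoˡ (0≤a² ½) (≤-trans (≤-reflexive (eq₁ (½ * h)))
           (+-mono-≤ (cov≥0 (sgn-monotone s) (sgn-monotone t) (sgn-odd s))
             (+-mono-≤ (U-sgn-C (trans (w-sym t s) wst≡1))
               (+-mono-≤ (cov≥0 (C-monotone s) (sgn-monotone t) (C-odd s))
                         (cov≥0 (C-monotone s) (C-monotone t) (C-odd s)))))) ⟩
    ½ * ½ * (U (λ z → X s z * X t z) + (U (λ z → X s z * C t z) + (U (λ z → C s z * X t z) + U (λ z → C s z * C t z))))
      ≡⟨ cong (½ * ½ *_) (sym (U-+³ (λ z → X s z * X t z) (λ z → X s z * C t z) (λ z → C s z * X t z) (λ z → C s z * C t z))) ⟩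
    ½ * ½ * U (λ z → X s z * X t z + (X s z * C t z + (C s z * X t z + C s z * C t z)))
      ≡⟨ sym (E-* coin (½ * ½) (λ z → X s z * X t z + (X s z * C t z + (C s z * X t z + C s z * C t z)))) ⟩
    U (λ z → ½ * ½ * (X s z * X t z + (X s z * C t z + (C s z * X t z + C s z * C t z))))
      ≡⟨ E-cong coin (λ z → eq₂ (X s z) (X t z) (C s z) (C t z)) ⟩
    U (λ z → α s z * α t z) ∎
    where
    open ≤-Reasoning
    X : Fin n → Cube n → ℚ
    X v z = sgn (lookup z v)
    sgn-odd : ∀ v → Odd (X v)
    sgn-odd v z = sgn-negate z v
    cov≥0 : ∀ {F G : Cube n → ℚ} → Monotone F → Monotone G → Odd F → 0ℚ ≤ U (λ z → F z * G z)
    cov≥0 {F} {G} mF mG oF = ≤-trans (≤-reflexive (sym (trans (cong (_* U G) (U-odd oF)) (*-zeroˡ (U G))))) (harris F G mF mG)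
    eq₁ : ∀ x → x ≡ 0ℚ + (x + (0ℚ + 0ℚ))
    eq₁ = solve-∀ ring
    eq₂ : ∀ x y c d → ½ * ½ * (x * y + (x * d + (c * y + c * d))) ≡ (½ * x + ½ * c) * (½ * y + ½ * d)
    eq₂ = solve-∀ ring

  -- Independent fair colours would give 1/4; the factor 1 + h/8 is the advantage of an adjacent
  -- pair.
  κ : ℚ
  κ = ½ * ½ * (1ℚ + ½ * ½ * (½ * h))

  U-p*p : ∀ {s t} → w s t ≡ 1ℚ → κ ≤ U (λ z → p s z * p t z)
  U-p*p {s} {t} wst≡1 = begin
    κ
      ≤⟨ *-monoˡ (0≤a² ½) (+-monoʳ-≤ 1ℚ (U-α*α wst≡1)) ⟩
    ½ * ½ * (1ℚ + U (λ z → α s z * α t z))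
      ≡⟨ cong (½ * ½ *_) (eq₁ (U (λ z → α s z * α t z))) ⟩
    ½ * ½ * (1ℚ + (0ℚ + (0ℚ + U (λ z → α s z * α t z))))
      ≡⟨ cong (½ * ½ *_) (sym (trans (U-+³ (λ _ → 1ℚ) (α s) (α t) (λ z → α s z * α t z))
           (cong₂ (λ x y → x + y) (E-const {n} coin 1ℚ) (cong₂ (λ x y → x + (y + U (λ z → α s z * α t z))) (U-α s) (U-α t))))) ⟩
    ½ * ½ * U (λ z → 1ℚ + (α s z + (α t z + α s z * α t z)))
      ≡⟨ sym (E-* coin (½ * ½) (λ z → 1ℚ + (α s z + (α t z + α s z * α t z)))) ⟩
    U (λ z → ½ * ½ * (1ℚ + (α s z + (α t z + α s z * α t z))))
      ≡⟨ E-cong coin (λ z → eq₂ (α s z) (α t z)) ⟩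
    U (λ z → p s z * p t z) ∎
    where
    open ≤-Reasoning
    eq₁ : ∀ x → 1ℚ + x ≡ 1ℚ + (0ℚ + (0ℚ + x))
    eq₁ = solve-∀ ring
    eq₂ : ∀ x y → ½ * ½ * (1ℚ + (x + (y + x * y))) ≡ (½ + ½ * x) * (½ + ½ * y)
    eq₂ = solve-∀ ring

  Clique : Subset n → Set
  Clique f = ∀ s t → s ∈ f → t ∈ f → w s t ≡ 1ℚ

  -- Negating all signs exchanges `p` with 1 - p, so the two colours are equally likely to fill the
  -- edge and one estimate serves both.
  U-mono-edge : ∀ f {m} → ∣ f ∣ ≡ suc (suc m) → Clique f →
    (κ + κ) * 1/2^ m ≤ U (λ z → prod f (λ v → p v z) + prod f (λ v → 1ℚ - p v z))
  U-mono-edge f {m} eq adj = begin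
    (κ + κ) * 1/2^ m
      ≡⟨ *-distribʳ-+ (1/2^ m) κ κ ⟩
    κ * 1/2^ m + κ * 1/2^ m
      ≤⟨ +-mono-≤ gain gain ⟩
    U P + U P
      ≡⟨ cong (U P +_) (sym (U-negate P)) ⟩
    U P + U (P ∘ negate)
      ≡⟨ cong (U P +_) (E-cong coin (λ z → prod-cong f (λ v → p-negate v z))) ⟩
    U P + U (λ z → prod f (λ v → 1ℚ - p v z))
      ≡⟨ sym (E-+ coin P (λ z → prod f (λ v → 1ℚ - p v z))) ⟩
    U (λ z → P z + prod f (λ v → 1ℚ - p v z)) ∎
    where
    open ≤-Reasoning
    P : Cube n → ℚ
    P z = prod f (λ v → p v z)
    gain : κ * 1/2^ m ≤ U P
    gain = prod-gain f {φ = p} eq p-fair (λ s∈f t∈f → U-p*p (adj _ _ s∈f t∈f))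

  T : Cube n → ℚ
  T z = ∑ (λ v → α v z)

  mean-p : ∀ z → mean (λ v → p v z) ≡ T z
  mean-p z = ∑-cong (λ v → eq (α v z))
    where
    eq : ∀ s → ½ + ½ * s - (1ℚ - (½ + ½ * s)) ≡ s
    eq = solve-∀ ring

  T-odd : Odd T
  T-odd z = trans (∑-cong (λ v → α-odd v z)) (∑-neg (λ v → α v z))

  α-lipschitz : ∀ v z i → α v (z [ i ]≔ true) ≤ α v (z [ i ]≔ false) + (mem v ⁅ i ⁆ + h * w i v)
  α-lipschitz v z i = begin
    ½ * sgn (lookup (z [ i ]≔ true) v) + ½ * C v (z [ i ]≔ true)
      ≤⟨ +-mono-≤ (*-monoˡ 0≤½ (sgn-lipschitz v z i)) (*-monoˡ 0≤½ C-lipschitz) ⟩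
    ½ * (sgn (lookup (z [ i ]≔ false) v) + (mem v ⁅ i ⁆ + mem v ⁅ i ⁆)) + ½ * (C v (z [ i ]≔ false) + h * (w v i + w v i))
      ≡⟨ eq (sgn (lookup (z [ i ]≔ false) v)) (mem v ⁅ i ⁆) (C v (z [ i ]≔ false)) h (w v i) ⟩
    α v (z [ i ]≔ false) + (mem v ⁅ i ⁆ + h * w v i)
      -- Symmetry of the weights turns the later sum over `v` into a row sum, which `∑w≤R` bounds.
      ≡⟨ cong (λ q → α v (z [ i ]≔ false) + (mem v ⁅ i ⁆ + h * q)) (w-sym v i) ⟩
    α v (z [ i ]≔ false) + (mem v ⁅ i ⁆ + h * w i v) ∎
    where
    open ≤-Reasoning
    eq : ∀ x m c h w → ½ * (x + (m + m)) + ½ * (c + h * (w + w)) ≡ (½ * x + ½ * c) + (m + h * w)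
    eq = solve-∀ ring
    0≤w = proj₁ (w-isProb v i)
    C-lipschitz : C v (z [ i ]≔ true) ≤ C v (z [ i ]≔ false) + h * (w v i + w v i)
    C-lipschitz = ≤-trans
      (≤-reflexive (cong clamp (trans (cong (h *_) (linear-diff (w v) z i)) (*-distribˡ-+ h (S v (z [ i ]≔ false)) (w v i + w v i)))))
      (clamp-lipschitz (h * S v (z [ i ]≔ false)) (0≤* 0≤h (0≤+ 0≤w 0≤w)))

  B : ℚ
  B = 1ℚ + h * R

  T-lipschitz : ∀ z i → T (z [ i ]≔ true) ≤ T (z [ i ]≔ false) + B
  T-lipschitz z i = begin
    T (z [ i ]≔ true)
      ≤⟨ ∑-mono (λ v → α-lipschitz v z i) ⟩
    ∑ (λ v → α v (z [ i ]≔ false) + (mem v ⁅ i ⁆ + h * w i v))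
      ≡⟨ trans (∑-+ (λ v → α v (z [ i ]≔ false)) (λ v → mem v ⁅ i ⁆ + h * w i v))
           (cong (T (z [ i ]≔ false) +_) (∑-+ (λ v → mem v ⁅ i ⁆) (λ v → h * w i v))) ⟩
    T (z [ i ]≔ false) + (∑ (λ v → mem v ⁅ i ⁆) + ∑ (λ v → h * w i v))
      ≡⟨ cong₂ (λ s t → T (z [ i ]≔ false) + (s + t)) (trans (∑-mem ⁅ i ⁆) (cong ι (∣⁅x⁆∣≡1 i))) (∑-* h (w i)) ⟩
    T (z [ i ]≔ false) + (1ℚ + h * ∑ (w i))
      ≤⟨ +-monoʳ-≤ (T (z [ i ]≔ false)) (+-monoʳ-≤ 1ℚ (*-monoˡ 0≤h (∑w≤R i))) ⟩
    T (z [ i ]≔ false) + B ∎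
    where open ≤-Reasoning

  U-T² : U (λ z → T z * T z) ≤ ½ * ½ * (ι n * (B * B))
  U-T² = begin
    U (λ z → T z * T z)
      ≤⟨ efron-stein T (λ _ → B) (λ z i → ∑-mono (λ v → α-monotone v z i)) T-lipschitz ⟩
    U T * U T + ½ * ½ * ∑ {n} (λ _ → B * B)
      ≡⟨ cong₂ (λ s t → s * s + ½ * ½ * t) (U-odd T-odd) (∑-const n (B * B)) ⟩
    0ℚ * 0ℚ + ½ * ½ * (ι n * (B * B))
      ≡⟨ +-identityˡ (½ * ½ * (ι n * (B * B))) ⟩
    ½ * ½ * (ι n * (B * B)) ∎
    where open ≤-Reasoning

  -- A single colouring must have many monochromatic edges and a small imbalance, so one weighted
  -- combination of the two is averaged. First the signs `z` are fixed, then the colouring `x` drawn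
  -- with the biases they determine.
  good-colouring : ∀ (es : List (Subset n)) {m} → All (λ f → ∣ f ∣ ≡ suc (suc m)) es →
    All Clique es →
    ∀ {W D} → 0ℚ ≤ W → 0ℚ ≤ D →
    ∃ λ x → W * (ι (length es) * ((κ + κ) * 1/2^ m)) + - D * (½ * ½ * (ι n * (B * B)) + ι n)
      ≤ W * ∑ᴸ es (λ f → mono f x) + - D * (imbalance x * imbalance x)
  good-colouring es {m} unif adj {W} {D} 0≤W 0≤D =
    let z , Uφ≤ = average-attained coin-isProb φ
        x , Eψ≤ = average-attained (p-isProb z) ψ
    in x , ≤-trans (≤-trans lower Uφ≤) (≤-trans (φ≤Eψ z) Eψ≤)
    where
    open ≤-Reasoning
    ψ φ : Cube n → ℚ
    ψ x = W * ∑ᴸ es (λ f → mono f x) + - D * (imbalance x * imbalance x)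
    P : Subset n → Cube n → ℚ
    P f z = prod f (λ v → p v z) + prod f (λ v → 1ℚ - p v z)
    -- A lower bound for the conditional mean of `ψ` given the signs: the imbalance has conditional
    -- mean `T z` and conditional variance at most n.
    φ z = W * ∑ᴸ es (λ f → P f z) + - D * (T z * T z + ι n)

    E-combination : ∀ {k} (q : Fin k → ℚ) (F G : Cube k → ℚ) → E q (λ x → W * F x + - D * G x) ≡ W * E q F + - D * E q G
    E-combination q F G = trans (E-+ q (λ x → W * F x) (λ x → - D * G x)) (cong₂ _+_ (E-* q W F) (E-* q (- D) G))

    E-mono-edge : ∀ z f → E (λ v → p v z) (mono f) ≡ P f z
    E-mono-edge z f = trans (E-+ q (λ x → prod f (bit ∘ lookup x)) (λ x → prod f (bit ∘ not ∘ lookup x)))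
      (cong₂ _+_ (trans (E-prod q f bit) (prod-cong f (λ v → eq₁ (q v))))
                 (trans (E-prod q f (bit ∘ not)) (prod-cong f (λ v → eq₀ (q v)))))
      where
      q : Fin n → ℚ
      q v = p v z
      eq₁ : ∀ s → s * 1ℚ + (1ℚ - s) * 0ℚ ≡ s
      eq₁ = solve-∀ ring
      eq₀ : ∀ s → s * 0ℚ + (1ℚ - s) * 1ℚ ≡ 1ℚ - s
      eq₀ = solve-∀ ring

    φ≤Eψ : ∀ z → φ z ≤ E (λ v → p v z) ψ
    φ≤Eψ z = begin
      W * ∑ᴸ es (λ f → P f z) + - D * (T z * T z + ι n)
        ≡⟨ cong₂ (λ s t → W * s + - D * (t * t + ι n))
             (sym (trans (E-∑ᴸ q es mono) (∑ᴸ-cong (All.tabulate {xs = es} (λ {f} _ → E-mono-edge z f))))) (sym (mean-p z)) ⟩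
      W * E q (λ x → ∑ᴸ es (λ f → mono f x)) + - D * (mean q * mean q + ι n)
        ≤⟨ +-monoʳ-≤ (W * E q (λ x → ∑ᴸ es (λ f → mono f x))) (*-antimonoˡ 0≤D (E-imbalance² (p-isProb z))) ⟩
      W * E q (λ x → ∑ᴸ es (λ f → mono f x)) + - D * E q (λ x → imbalance x * imbalance x)
        ≡⟨ sym (E-combination q (λ x → ∑ᴸ es (λ f → mono f x)) (λ x → imbalance x * imbalance x)) ⟩
      E q ψ ∎
      where
      q : Fin n → ℚ
      q v = p v z

    lower : W * (ι (length es) * ((κ + κ) * 1/2^ m)) + - D * (½ * ½ * (ι n * (B * B)) + ι n) ≤ U φ
    lower = begin
      W * (ι (length es) * ((κ + κ) * 1/2^ m)) + - D * (½ * ½ * (ι n * (B * B)) + ι n)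
        ≤⟨ +-mono-≤ (*-monoˡ 0≤W edges≤) (*-antimonoˡ 0≤D (+-monoˡ-≤ (ι n) U-T²)) ⟩
      W * U (λ z → ∑ᴸ es (λ f → P f z)) + - D * (U (λ z → T z * T z) + ι n)
        ≡⟨ cong (λ s → W * U (λ z → ∑ᴸ es (λ f → P f z)) + - D * s)
             (sym (trans (E-+ coin (λ z → T z * T z) (λ _ → ι n)) (cong (U (λ z → T z * T z) +_) (E-const {n} coin (ι n))))) ⟩
      W * U (λ z → ∑ᴸ es (λ f → P f z)) + - D * U (λ z → T z * T z + ι n)
        ≡⟨ sym (E-combination coin (λ z → ∑ᴸ es (λ f → P f z)) (λ z → T z * T z + ι n)) ⟩
      U φ ∎
      where
      edges≤ : ι (length es) * ((κ + κ) * 1/2^ m) ≤ U (λ z → ∑ᴸ es (λ f → P f z))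
      edges≤ = begin
        ι (length es) * ((κ + κ) * 1/2^ m)       ≡⟨ sym (∑ᴸ-const ((κ + κ) * 1/2^ m) es) ⟩
        ∑ᴸ es (λ _ → (κ + κ) * 1/2^ m)           ≤⟨ ∑ᴸ-mono (All.zipWith (λ {f} (eq , clique) → U-mono-edge f eq clique) (unif , adj)) ⟩
        ∑ᴸ es (λ f → U (P f))                    ≡⟨ sym (E-∑ᴸ coin es P) ⟩
        U (λ z → ∑ᴸ es (λ f → P f z))            ∎

-- Reciprocals and an integer substitute for √d

1/ₙ_ : (k : ℕ) .{{_ : ℕ.NonZero k}} → ℚ
1/ₙ k = ℤ.+ 1 / k

1/ₙ-inverse : ∀ k → 1/ₙ (suc k) * ι (suc k) ≡ 1ℚ
1/ₙ-inverse k = toℚᵘ-injective (begin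
  toℚᵘ (1/ₙ (suc k) * ι (suc k))
    ≈⟨ toℚᵘ-homo-* (1/ₙ (suc k)) (ι (suc k)) ⟩
  toℚᵘ (1/ₙ (suc k)) ℚᵘ.* toℚᵘ (ι (suc k))
    ≈⟨ ℚᵘ.*-cong (toℚᵘ-fromℚᵘ (ℚᵘ.mkℚᵘ (ℤ.+ 1) k)) (toℚᵘ-fromℚᵘ (ℚᵘ.mkℚᵘ (ℤ.+ suc k) 0)) ⟩
  ℚᵘ.mkℚᵘ (ℤ.+ 1) k ℚᵘ.* ℚᵘ.mkℚᵘ (ℤ.+ suc k) 0
    ≈⟨ ℚᵘ.*≡* (trans (ℤ.*-identityʳ (ℤ.+ 1 ℤ.* ℤ.+ suc k)) (cong (ℤ.+ 1 ℤ.*_) (sym (ℤ.*-identityʳ (ℤ.+ suc k))))) ⟩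
  toℚᵘ 1ℚ ∎)
  where open ℚᵘ.≃-Reasoning

0<1/ₙ : ∀ k → 0ℚ < 1/ₙ (suc k)
0<1/ₙ k = positive⁻¹ (1/ₙ (suc k)) {{normalize-pos 1 (suc k)}}

0<ι : ∀ k .{{_ : ℕ.NonZero k}} → 0ℚ < ι k
0<ι k = positive⁻¹ (ι k) {{normalize-pos k 1}}

0<* : 0ℚ < a → 0ℚ < b → 0ℚ < a * b
0<* {a} {b} p q = positive⁻¹ (a * b) {{pos*pos⇒pos a {{positive p}} b {{positive q}}}}

0<1/2^ : ∀ m → 0ℚ < 1/2^ m
0<1/2^ m = positive⁻¹ (1/2^ m) {{normalize-pos 1 (2 ℕ.^ m) {{ℕ.m^n≢0 2 m}}}}

1/ₙ≤1 : ∀ k → 1/ₙ (suc k) ≤ 1ℚ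
1/ₙ≤1 k = ≤-trans (≤-reflexive (sym (*-identityʳ (1/ₙ (suc k)))))
  (≤-trans (*-monoˡ (<⇒≤ (0<1/ₙ k)) (ι-mono {1} {suc k} (ℕ.s≤s ℕ.z≤n))) (≤-reflexive (1/ₙ-inverse k)))

-- As d grows, the root is kept until its square falls below d and is then raised by one. A positive
-- integer at most doubles when raised, so the new square is at most four times the old one, which
-- was below d.
approximate-√ : ∀ d .{{_ : ℕ.NonZero d}} → ∃ λ q → d ℕ.≤ suc q ℕ.* suc q × suc q ℕ.* suc q ℕ.≤ 4 ℕ.* d
approximate-√ (suc zero)    = 0 , ℕ.≤-refl , ℕ.s≤s ℕ.z≤n
approximate-√ (suc (suc d)) with approximate-√ (suc d)
... | q , lo , hi with suc (suc d) ℕ.≤? suc q ℕ.* suc q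
... | yes le = q , le , ℕ.≤-trans hi (ℕ.*-monoʳ-≤ 4 (ℕ.n≤1+n (suc d)))
... | no ¬le = suc q ,
  ℕ.≤-trans (ℕ.s≤s lo) (ℕ.*-mono-< {suc q} {suc (suc q)} {suc q} {suc (suc q)} ℕ.≤-refl ℕ.≤-refl) ,
  (begin
    suc (suc q) ℕ.* suc (suc q)                ≤⟨ ℕ.*-mono-≤ step step ⟩
    (2 ℕ.* suc q) ℕ.* (2 ℕ.* suc q)            ≡⟨ ℕ.[m*n]*[o*p]≡[m*o]*[n*p] 2 (suc q) 2 (suc q) ⟩
    4 ℕ.* (suc q ℕ.* suc q)                    ≤⟨ ℕ.*-monoʳ-≤ 4 (ℕ.<⇒≤ (ℕ.≰⇒> ¬le)) ⟩
    4 ℕ.* suc (suc d)                          ∎)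
  where
  open ℕ.≤-Reasoning
  step : suc (suc q) ℕ.≤ 2 ℕ.* suc q
  step = ℕ.s≤s (ℕ.≤-trans (ℕ.m≤n+m (suc q) q) (ℕ.≤-reflexive (cong (q ℕ.+_) (sym (ℕ.+-identityʳ (suc q))))))

-- AM-GM, in the form 2 W x ≤ x² + W², replaces the cost x of rebalancing by its square, whose mean is known.
trade-off : ∀ {W e K M D V Y x s} → 0ℚ < W →
  (W + W) * (e * K) + - D * V ≤ (W + W) * M + - D * Y →
  s ≤ e - M + x → D * Y ≡ x * x → D * V ≤ W * W → s ≤ e - e * K + W
trade-off {W} {e} {K} {M} {D} {V} {Y} {x} {s} 0<W h₁ h₂ h₃ h₄ =
  *-cancelˡ-≤-pos (W + W) {{positive (+-mono-< 0<W 0<W)}}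
    (≤-by (0≤+ (0≤* (<⇒≤ (+-mono-< 0<W 0<W)) (a≤b⇒0≤b-a h₂))
          (0≤+ (a≤b⇒0≤b-a h₁) (0≤+ (a≤b⇒0≤b-a h₄)
          (0≤+ (a≤b⇒0≤b-a (≤-reflexive (sym h₃))) (0≤a² (x - W))))))
      (eq W e K M D V Y x s))
  where
  eq : ∀ W e K M D V Y x s →
    (W + W) * s + ((W + W) * (e - M + x - s)
      + (((W + W) * M + - D * Y - ((W + W) * (e * K) + - D * V))
      + ((W * W - D * V) + ((D * Y - x * x) + (x - W) * (x - W)))))
    ≡ (W + W) * (e - e * K + W)
  eq = solve-∀ ring

-- Since q is at least √d, a gap of c N q is more than is asked for.
≤-−√ : ∀ {x y c N q} {d : ℕ} → 0ℚ ≤ c * N → 0ℚ ≤ q → ι d ≤ q * q → x + c * N * q ≤ y → x ≤ y −[ c * N ]√ d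
≤-−√ {x} {y} {c} {N} {q} {d} 0≤cN 0≤q d≤q² gap =
  ≤-trans (≤-by (0≤* 0≤cN 0≤q) refl) gap ,
  (begin
    c * N * (c * N) * ι d          ≤⟨ *-monoˡ (0≤a² (c * N)) d≤q² ⟩
    c * N * (c * N) * (q * q)      ≡⟨ a²b²≡[ab]² (c * N) q ⟩
    c * N * q * (c * N * q)        ≤⟨ *-mono (0≤* 0≤cN 0≤q) (≤-trans (0≤* 0≤cN 0≤q) gap′) gap′ gap′ ⟩
    (y - x) * (y - x)              ∎)
  where
  open ≤-Reasoning
  gap′ : c * N * q ≤ y - x
  gap′ = ≤-trans (≤-reflexive (sym (a+b-a≡b x (c * N * q)))) (+-monoˡ-≤ (- x) gap)

-- Choice of constants and the final estimate

module Bound (m : ℕ) where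

  r : ℕ
  r = suc (suc m)

  ρ t η : ℚ
  ρ = 1/2^ suc m
  t = 1/ₙ r
  -- Chosen so that the gain over a uniform random colouring is at least 2 η n q: one half pays for
  -- rebalancing, the other is the claimed improvement.
  η = ρ * (1/ₙ 256 * (t * t))

  0<η : 0ℚ < η
  0<η = 0<* (0<1/2^ (suc m)) (0<* (0<1/ₙ 255) (0<* (0<1/ₙ (suc m)) (0<1/ₙ (suc m))))

  module _ {n d : ℕ} (H : Hypergraph n) (uniform : Uniform r H) (regular : Regular d H) where

    e≡tnd : ι (e H) ≡ t * (ι n * ι d)
    e≡tnd = begin
      ι (e H)                 ≡⟨ sym (*-identityˡ (ι (e H))) ⟩
      1ℚ * ι (e H)            ≡⟨ cong (_* ι (e H)) (sym (1/ₙ-inverse (suc m))) ⟩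
      t * ι r * ι (e H)       ≡⟨ *-assoc t (ι r) (ι (e H)) ⟩
      t * (ι r * ι (e H))     ≡⟨ cong (t *_) (sym (handshake H uniform regular)) ⟩
      t * (ι n * ι d)         ∎
      where open ≡-Reasoning

    -- By the handshake identity there are no edges, and every term vanishes. This case stands apart
    -- because `approximate-√` needs d > 0 and `trade-off` needs a positive `W`.
    degenerate : ι n * ι d ≡ 0ℚ → ι (bw H) ≤ ι (e H) * (1ℚ - ρ) −[ η * ι n ]√ d
    degenerate nd≡0 =
      ≤-trans (≤-trans (ι-mono (length-filter (crosses? _) (edges H))) (≤-reflexive e≡0))
              (≤-reflexive (sym (trans (cong (_* (1ℚ - ρ)) e≡0) (*-zeroˡ (1ℚ - ρ))))) ,
      ≤-trans (≤-reflexive (trans (eq η (ι n) (ι d)) (trans (cong (η * (η * ι n) *_) nd≡0) (*-zeroʳ (η * (η * ι n))))))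
              (0≤a² (ι (e H) * (1ℚ - ρ) - ι (bw H)))
      where
      e≡0 : ι (e H) ≡ 0ℚ
      e≡0 = trans e≡tnd (trans (cong (t *_) nd≡0) (*-zeroʳ t))
      eq : ∀ c n d → c * n * (c * n) * d ≡ c * (c * n) * (n * d)
      eq = solve-∀ ring

  module NonDegenerate {n d : ℕ} .{{_ : ℕ.NonZero n}} .{{_ : ℕ.NonZero d}} (H : Hypergraph n)
    (uniform : Uniform r H) (regular : Regular d H) (d²≤ : d ≤[ ½ * η ]√ n) where

    q′ : ℕ
    q′ = proj₁ (approximate-√ d)

    q s h R W : ℚ
    q = ι (suc q′)
    s = 1/ₙ (suc q′)
    -- Of order 1/(r √d). The quarter makes 4h = t s, so `h-small` reduces to r + 1 ≤ r².
    h = ½ * ½ * (t * s)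
    R = ι r * ι d
    W = η * ι n * q

    0≤t = <⇒≤ (0<1/ₙ (suc m))
    0≤s = <⇒≤ (0<1/ₙ q′)
    0≤q = 0≤ι (suc q′)

    d≤q² : ι d ≤ q * q
    d≤q² = ≤-trans (ι-mono (proj₁ (proj₂ (approximate-√ d)))) (≤-reflexive (ι-* (suc q′) (suc q′)))

    q²≤4d : q * q ≤ ι 4 * ι d
    q²≤4d = ≤-trans (≤-reflexive (sym (ι-* (suc q′) (suc q′))))
      (≤-trans (ι-mono (proj₂ (proj₂ (approximate-√ d)))) (≤-reflexive (ι-* 4 d)))

    0≤h : 0ℚ ≤ h
    0≤h = 0≤* (0≤a² ½) (0≤* 0≤t 0≤s)

    h≤½ : h ≤ ½
    h≤½ = ≤-trans (*-monoˡ (0≤a² ½) (*-mono 0≤t 0≤1 (1/ₙ≤1 (suc m)) (1/ₙ≤1 q′))) (≤ᵇ⇒≤ _)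

    ss*d≤1 : s * s * ι d ≤ 1ℚ
    ss*d≤1 = begin
      s * s * ι d          ≤⟨ *-monoˡ (0≤a² s) d≤q² ⟩
      s * s * (q * q)      ≡⟨ a²b²≡[ab]² s q ⟩
      s * q * (s * q)      ≡⟨ cong (λ x → x * x) (1/ₙ-inverse q′) ⟩
      1ℚ * 1ℚ              ∎
      where open ≤-Reasoning

    h-small : (h + h + (h + h)) * (h + h + (h + h)) * (R + 1ℚ) ≤ 1ℚ
    h-small = begin
      (h + h + (h + h)) * (h + h + (h + h)) * (R + 1ℚ)    ≡⟨ eq₁ t s (ι r) (ι d) ⟩
      t * t * (ι r * (s * s * ι d) + s * s)
        ≤⟨ *-monoˡ (0≤a² t) (+-mono-≤ (*-monoˡ (0≤ι r) ss*d≤1) (*-mono 0≤s 0≤1 (1/ₙ≤1 q′) (1/ₙ≤1 q′))) ⟩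
      t * t * (ι r * 1ℚ + 1ℚ * 1ℚ)                        ≡⟨ cong (t * t *_) (trans (cong (_+ 1ℚ) (*-identityʳ (ι r))) (sym (ι-+ r 1))) ⟩
      t * t * ι (r ℕ.+ 1)                                 ≤⟨ *-monoˡ (0≤a² t) (≤-trans (ι-mono r+1≤r²) (≤-reflexive (ι-* r r))) ⟩
      t * t * (ι r * ι r)                                 ≡⟨ a²b²≡[ab]² t (ι r) ⟩
      t * ι r * (t * ι r)                                 ≡⟨ cong (λ x → x * x) (1/ₙ-inverse (suc m)) ⟩
      1ℚ * 1ℚ                                             ∎
      where
      open ≤-Reasoning
      eq₁ : ∀ t s r d → (½ * ½ * (t * s) + ½ * ½ * (t * s) + (½ * ½ * (t * s) + ½ * ½ * (t * s)))
        * (½ * ½ * (t * s) + ½ * ½ * (t * s) + (½ * ½ * (t * s) + ½ * ½ * (t * s))) * (r * d + 1ℚ)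
        ≡ t * t * (r * (s * s * d) + s * s)
      eq₁ = solve-∀ ring
      r+1≤r² : r ℕ.+ 1 ℕ.≤ r ℕ.* r
      r+1≤r² = ℕ.+-monoʳ-≤ r (ℕ.s≤s ℕ.z≤n)

    w : Fin n → Fin n → ℚ
    w = adjacency (edges H)

    open Colouring w (adjacency-isProb (edges H)) (adjacency-sym (edges H)) R
      (∑-adjacency H uniform regular) h 0≤h h≤½ h-small

    B≤2q : B ≤ q + q
    B≤2q = begin
      1ℚ + h * R                              ≡⟨ eq₁ t s (ι r) (ι d) ⟩
      1ℚ + ½ * ½ * (t * ι r * (s * ι d))      ≡⟨ cong (λ x → 1ℚ + ½ * ½ * (x * (s * ι d))) (1/ₙ-inverse (suc m)) ⟩
      1ℚ + ½ * ½ * (1ℚ * (s * ι d))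
        ≤⟨ +-mono-≤ (ι-mono {1} {suc q′} (ℕ.s≤s ℕ.z≤n)) (*-monoˡ (0≤a² ½) (*-monoˡ 0≤1 (*-monoˡ 0≤s d≤q²))) ⟩
      q + ½ * ½ * (1ℚ * (s * (q * q)))        ≡⟨ eq₂ s q ⟩
      q + ½ * ½ * ((s * q) * q)               ≡⟨ cong (λ x → q + ½ * ½ * (x * q)) (1/ₙ-inverse q′) ⟩
      q + ½ * ½ * (1ℚ * q)                    ≤⟨ +-monoʳ-≤ q (≤-by (0≤* (0≤+ 0≤½ (0≤a² ½)) 0≤q) (eq₃ q)) ⟩
      q + q                                   ∎
      where
      open ≤-Reasoning
      eq₁ : ∀ t s r d → 1ℚ + ½ * ½ * (t * s) * (r * d) ≡ 1ℚ + ½ * ½ * (t * r * (s * d))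
      eq₁ = solve-∀ ring
      eq₂ : ∀ s q → q + ½ * ½ * (1ℚ * (s * (q * q))) ≡ q + ½ * ½ * ((s * q) * q)
      eq₂ = solve-∀ ring
      eq₃ : ∀ q → ½ * ½ * (1ℚ * q) + (½ + ½ * ½) * q ≡ q
      eq₃ = solve-∀ ring

    0≤B : 0ℚ ≤ B
    0≤B = 0≤+ 0≤1 (0≤* 0≤h (0≤* (0≤ι r) (0≤ι d)))

    -- The hypothesis d ≤ ε √n enters here. The mean square imbalance is at most 2 n q² by `B≤2q`,
    -- and d² ≤ η² n / 4, so the product is at most W²/2.
    V≤W² : ι d * ι d * (½ * ½ * (ι n * (B * B)) + ι n) ≤ W * W
    V≤W² = begin
      ι d * ι d * (½ * ½ * (ι n * (B * B)) + ι n)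
        ≤⟨ *-monoˡ (0≤a² (ι d)) (+-mono-≤ (*-monoˡ (0≤a² ½) (*-monoˡ (0≤ι n) (*-mono 0≤B (≤-trans 0≤B B≤2q) B≤2q B≤2q)))
             (≤-trans (≤-reflexive (sym (*-identityʳ (ι n)))) (*-monoˡ (0≤ι n) (1≤a⇒1≤a² (ι-mono {1} {suc q′} (ℕ.s≤s ℕ.z≤n)))))) ⟩
      ι d * ι d * (½ * ½ * (ι n * ((q + q) * (q + q))) + ι n * (q * q))
        ≤⟨ *-mono (0≤a² (ι d)) (0≤+ (0≤* (0≤a² ½) (0≤* (0≤ι n) (0≤a² (q + q)))) (0≤* (0≤ι n) (0≤a² q))) d²≤ ≤-refl ⟩
      ½ * η * (½ * η) * ι n * (½ * ½ * (ι n * ((q + q) * (q + q))) + ι n * (q * q))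
        ≤⟨ ≤-by (0≤* 0≤½ (0≤a² W)) (eq η (ι n) q) ⟩
      W * W ∎
      where
      open ≤-Reasoning
      eq : ∀ c n q → ½ * c * (½ * c) * n * (½ * ½ * (n * ((q + q) * (q + q))) + n * (q * q)) + ½ * (c * n * q * (c * n * q))
        ≡ c * n * q * (c * n * q)
      eq = solve-∀ ring

    0<W : 0ℚ < W
    0<W = 0<* (0<* 0<η (0<ι n)) (0<ι (suc q′))

    -- The right side is ρ e (1 + h/8). With e = t n d and h = t s / 4 its excess over ρ e is ρ t² n
    -- (s d) / 32, and q² ≤ 4d gives s d ≥ q/4. This leaves ρ t² n q / 128, which is 2W.
    gain : 1/2^ suc m * ι (e H) + (W + W) ≤ ι (e H) * ((κ + κ) * 1/2^ m)
    gain = begin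
      ρ * ι (e H) + (W + W)
        ≤⟨ ≤-by (0≤* (0≤* (<⇒≤ (0<1/2^ (suc m))) (0≤* (<⇒≤ (0<1/ₙ 127)) (0≤* (0≤a² t) (0≤ι n)))) (a≤b⇒0≤b-a q≤4sd))
             (trans (cong (λ x → ρ * x + (W + W) + ρ * (1/ₙ 128 * (t * t * ι n)) * (ι 4 * (s * ι d) - q)) e≡) (eq₁ ρ t (ι n) (ι d) q s)) ⟩
      t * (ι n * ι d) * ((κ + κ) * ((1ℚ + 1ℚ) * ρ))
        ≡⟨ cong₂ (λ x y → x * ((κ + κ) * y)) (sym e≡) (trans (cong ((1ℚ + 1ℚ) *_) (1/2^-suc m)) (eq₂ (1/2^ m))) ⟩
      ι (e H) * ((κ + κ) * 1/2^ m) ∎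
      where
      open ≤-Reasoning
      e≡ = e≡tnd H uniform regular
      q≤4sd : q ≤ ι 4 * (s * ι d)
      q≤4sd = begin
        q                     ≡⟨ sym (*-identityˡ q) ⟩
        1ℚ * q                ≡⟨ cong (_* q) (sym (1/ₙ-inverse q′)) ⟩
        s * q * q             ≡⟨ *-assoc s q q ⟩
        s * (q * q)           ≤⟨ *-monoˡ 0≤s q²≤4d ⟩
        s * (ι 4 * ι d)       ≡⟨ eq s (ι 4) (ι d) ⟩
        ι 4 * (s * ι d)       ∎
        where
        eq : ∀ s x d → s * (x * d) ≡ x * (s * d)
        eq = solve-∀ ring
      eq₁ : ∀ ρ t n d q s →
        ρ * (t * (n * d)) + (ρ * (1/ₙ 256 * (t * t)) * n * q + ρ * (1/ₙ 256 * (t * t)) * n * q)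
          + ρ * (1/ₙ 128 * (t * t * n)) * (ι 4 * (s * d) - q)
        ≡ t * (n * d) * ((½ * ½ * (1ℚ + ½ * ½ * (½ * (½ * ½ * (t * s))))
            + ½ * ½ * (1ℚ + ½ * ½ * (½ * (½ * ½ * (t * s))))) * ((1ℚ + 1ℚ) * ρ))
      eq₁ = solve-∀ ring
      eq₂ : ∀ x → (1ℚ + 1ℚ) * (½ * x) ≡ x
      eq₂ = solve-∀ ring

    main : ι (bw H) ≤ ι (e H) * (1ℚ - ρ) −[ η * ι n ]√ d
    main =
      -- `Clique` also asks for the pairs s = t, which is why closed neighbourhoods are used.
      let cliques = All.tabulate {xs = edges H} (λ f∈ a b a∈f b∈f → adjacency-edge f∈ a∈f b∈f)
          -- The weights are 2W and d²: after scaling by d², the squared imbalance is the square of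
          -- the rebalancing cost d k, as `trade-off` requires.
          x , good = good-colouring (edges H) {m} uniform cliques
            (<⇒≤ (+-mono-< 0<W 0<W)) (0≤a² (ι d))
          X , k , equi , cut≤ , k²≡ = rebalance H regular x
          bw≤ : ι (bw H) ≤ ι (e H) - ∑ᴸ (edges H) (λ f → mono f x) + ι d * ι k
          bw≤ = ≤-trans (ι-mono (ℕ.≤-trans (bw-minimal H X equi) cut≤))
            (≤-trans (≤-reflexive (trans (ι-+ (cutSize H x) (d ℕ.* k)) (cong (ι (cutSize H x) +_) (ι-* d k))))
              (+-monoˡ-≤ (ι d * ι k) (cutSize-≤ H (ℕ.s≤s ℕ.z≤n) uniform x)))
          bound = trade-off {W} {ι (e H)} {(κ + κ) * 1/2^ m} {∑ᴸ (edges H) (λ f → mono f x)}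
            {ι d * ι d} {½ * ½ * (ι n * (B * B)) + ι n} {imbalance x * imbalance x} 0<W good bw≤
            (trans (cong (ι d * ι d *_) (sym k²≡)) (a²b²≡[ab]² (ι d) (ι k))) V≤W²
      in ≤-−√ {ι (bw H)} {ι (e H) * (1ℚ - ρ)} {η} {ι n} {q} {d} (<⇒≤ (0<* 0<η (0<ι n))) 0≤q d≤q²
        (≤-trans (+-monoˡ-≤ W bound) (≤-by (a≤b⇒0≤b-a gain) (eq₂ (ι (e H)) (ι (e H) * ((κ + κ) * 1/2^ m)) ρ W)))
      where
      eq₂ : ∀ e x ρ W → e - x + W + W + (x - (ρ * e + (W + W))) ≡ e * (1ℚ - ρ)
      eq₂ = solve-∀ ring

theorem1p1 : ∀ (r : ℕ) → 2 ℕ.≤ r →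
    ∃[ c ] ∃[ ε ] 0ℚ < c × 0ℚ < ε ×
    (∀ (n d : ℕ) (H : Hypergraph n) → Uniform r H → Regular d H →
    d ≤[ ε ]√ n →
    ι (bw H) ≤ ι (e H) * (1ℚ - 1/2^ (r ∸ 1)) −[ c * ι n ]√ d)
theorem1p1 (suc (suc m)) (ℕ.s≤s (ℕ.s≤s ℕ.z≤n)) = η , ½ * η , 0<η , 0<* (positive⁻¹ ½) 0<η , bound
  where
  open Bound m
  bound : ∀ (n d : ℕ) (H : Hypergraph n) → Uniform r H → Regular d H → d ≤[ ½ * η ]√ n →
    ι (bw H) ≤ ι (e H) * (1ℚ - ρ) −[ η * ι n ]√ d
  bound zero    d       H uniform regular _ = degenerate H uniform regular (*-zeroˡ (ι d))
  bound (suc n) zero    H uniform regular _ = degenerate H uniform regular (*-zeroʳ (ι (suc n)))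
  bound (suc n) (suc d) H uniform regular d≤ = NonDegenerate.main H uniform regular d≤
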